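{- There exist a constant $c>0$ and an infinite family $\mathcal{H}$ of finite graphs such that every $H\in\mathcal{H}$ satisfies $\mathrm{iocp}(H)\le 1$ and $\omega(H)\ge 2$, the clique numbers $\omega(H)$ for $H\in\mathcal{H}$ are unbounded, and every $H\in\mathcal{H}$ satisfies $\chi(H)\ge c\,\frac{\omega(H)^2}{\log^2\omega(H)}$.
   Context: The induced odd cycle packing number $\mathrm{iocp}(G)$ of a graph $G$ is the maximum integer $k$ such that $G$ contains an induced subgraph consisting of $k$ pairwise vertex-disjoint odd cycles (triangles count as odd cycles). $\chi$ is the chromatic number and $\omega$ the clique number. -}

module Defs where

open import Level using (0ℓ)
open import Data.Nat using (ℕ; zero; suc; _+_; _*_; _≤_; _%_)
open import Data.Nat.Logarithm using (⌈log₂_⌉)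
open import Data.Fin using (Fin; toℕ)
open import Data.Product using (Σ; ∃; _×_)
open import Data.Sum using (_⊎_)
open import Data.Empty using (⊥)
open import Relation.Nullary using (¬_)
open import Relation.Binary.PropositionalEquality using (_≡_; _≢_)
open import Function.Definitions using (Injective)

record Graph : Set₁ where
  field
    n     : ℕ
    E     : Fin n → Fin n → Set
    sym   : ∀ {u v} → E u v → E v u
    irrefl : ∀ {u} → ¬ E u u
open Graph public

HasClique : Graph → ℕ → Set
HasClique G k = Σ (Fin k → Fin (n G)) λ f →
  Injective _≡_ _≡_ f × (∀ i j → i ≢ j → E G (f i) (f j))

CliqueNumber : Graph → ℕ → Set
CliqueNumber G w = HasClique G w × ¬ HasClique G (suc w)

ProperColouring : Graph → ℕ → Set
ProperColouring G k = Σ (Fin (n G) → Fin k) λ c →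
  ∀ u v → E G u v → c u ≢ c v

CycAdj : (m : ℕ) → Fin (suc m) → Fin (suc m) → Set
CycAdj m i j = (suc (toℕ i) % suc m ≡ toℕ j) ⊎ (suc (toℕ j) % suc m ≡ toℕ i)

oddLen : ℕ → ℕ
oddLen k = 3 + 2 * k

InducedOddCycle : (G : Graph) (k : ℕ) → (Fin (oddLen k) → Fin (n G)) → Set
InducedOddCycle G k f =
  Injective _≡_ _≡_ f ×
  (∀ i j → (E G (f i) (f j) → CycAdj (2 + 2 * k) i j) × (CycAdj (2 + 2 * k) i j → E G (f i) (f j)))

TwoInducedOddCycles : Graph → Set
TwoInducedOddCycles G =
  Σ ℕ λ k₁ → Σ ℕ λ k₂ →
  Σ (Fin (oddLen k₁) → Fin (n G)) λ f₁ →
  Σ (Fin (oddLen k₂) → Fin (n G)) λ f₂ →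
  InducedOddCycle G k₁ f₁ × InducedOddCycle G k₂ f₂ ×
  (∀ i j → f₁ i ≢ f₂ j) × (∀ i j → ¬ E G (f₁ i) (f₂ j))

IOCP≤1 : Graph → Set
IOCP≤1 G = ¬ TwoInducedOddCycles G

{-# OPTIONS --safe #-}
-- H is the complement of a graph F that contains neither a triangle nor K₃,₃. Then colour
-- classes of H have at most two vertices, every vertex lies on or next to an induced cycle of
-- length at least 5 in H, and two triangles of H with no edge between them would be a K₃,₃ in F.
-- So it suffices that F has n vertices and no independent set of size C √n log n.
--
-- F comes from a random graph G with edge probability 1/(M + 1), M = 8 √n, by scanning all
-- copies of the triangle and of K₃,₃ and deleting the edges of each copy that is still complete.
-- If a set S becomes independent, and Z is a set of pairs in S, then some edge-disjoint copies
-- that meet Z lie in G and cover G ∩ Z. Emptying a copy with e edges is an injection that multiplies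
-- the weight of a graph by Mᵉ, so this event has probability at most
--   (1 - 1/(M + 1))^|Z| · ∏ (1 + M⁻ᵉ),
-- the product running over the copies meeting Z. There are O(|Z| √n^(e - 1)) of these, the same
-- order for both patterns, so that the product is at most (1 + 1/M)^(|Z|/2); a union bound over S
-- finishes the proof.
module Submission where

open import Defs hiding (sym) renaming (n to order)
open import Data.Bool using (Bool; true; false; if_then_else_)
import Data.Bool.Properties as Bool
open import Data.Empty using (⊥)
open import Data.Fin as Fin using (Fin; zero; suc; _↑ˡ_; _↑ʳ_; combine)
import Data.Fin.Properties as Fin
open import Data.List as List using (List; []; _∷_; _++_; length; map; filter; cartesianProductWith; allFin)
open import Data.List.Properties using (length-map; length-++; length-tabulate)
open import Data.List.Membership.Propositional using (_∈_; _∉_)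
open import Data.List.Membership.Propositional.Properties
  using (∈-allFin; ∈-cartesianProductWith⁺; ∈-filter⁻; ∈-lookup; ∈-map⁺; ∈-map⁻; ∈-++⁺ˡ; ∈-++⁺ʳ)
open import Data.List.Relation.Unary.All as All using (All; []; _∷_)
import Data.List.Relation.Unary.All.Properties as All
open import Data.List.Relation.Unary.AllPairs using (AllPairs; []; _∷_; allPairs?)
open import Data.List.Relation.Unary.Any as Any using (here; there; satisfied)
open import Data.List.Relation.Unary.Unique.Propositional using (Unique)
open import Data.List.Relation.Unary.Unique.Propositional.Properties
  using (allFin⁺; cartesianProductWith⁺; filter⁺)
open import Data.Maybe using (Maybe; just; nothing; fromMaybe)
open import Data.Nat using (ℕ; zero; suc; _+_; _*_; _^_; _≤_; _<_; z≤n; s≤s; NonZero; >-nonZero⁻¹)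
open import Data.Nat.Logarithm using (⌈log₂_⌉; ⌈log₂⌉-mono-≤; ⌈log₂2^n⌉≡n)
open import Data.Nat.Properties
open import Data.Nat.Tactic.RingSolver using (solve-∀)
open import Data.Product using (Σ; ∃; _×_; _,_; proj₁; proj₂)
open import Data.Sum using (_⊎_; inj₁; inj₂; [_,_]′)
open import Data.Vec using (Vec; []; _∷_; lookup; tabulate; _[_]≔_)
open import Data.Vec.Properties using (lookup∘tabulate; lookup∘update; lookup∘update′)
open import Function using (_∘_)
open import Function.Definitions using (Injective)
open import Relation.Binary.Definitions using (tri<; tri≈; tri>)
open import Relation.Binary.PropositionalEquality
  using (_≡_; _≢_; refl; sym; trans; cong; cong₂; subst; subst₂; setoid; module ≡-Reasoning)
open import Relation.Nullary using (¬_; Dec; yes; no; does; contradiction; ¬?; _×-dec_; _→-dec_)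
open import Relation.Nullary.Decidable using (decidable-stable; map′)

-- Arithmetic

+-exchange : ∀ a b c d → (a + b) + (c + d) ≡ (a + c) + (b + d)
+-exchange = solve-∀

*-exchange : ∀ a b c d → (a * b) * (c * d) ≡ (a * c) * (b * d)
*-exchange = solve-∀

x*yz≡y*xz : ∀ x y z → x * (y * z) ≡ y * (x * z)
x*yz≡y*xz = solve-∀

xy*z≡y*xz : ∀ x y z → x * y * z ≡ y * (x * z)
xy*z≡y*xz = solve-∀

^-distribʳ-* : ∀ m a b → (a * b) ^ m ≡ a ^ m * b ^ m
^-distribʳ-* zero a b = refl
^-distribʳ-* (suc m) a b =
  trans (cong (a * b *_) (^-distribʳ-* m a b)) (*-exchange a b (a ^ m) (b ^ m))

-- Bernoulli's inequality 1 + m/Y ≤ (1 + 1/Y)^m, multiplied through by Y^(m + 1).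
bernoulli : ∀ Y m → (Y + m) * Y ^ m ≤ Y * suc Y ^ m
bernoulli Y zero = ≤-reflexive (cong (_* 1) (+-identityʳ Y))
bernoulli Y (suc m) = begin
  (Y + suc m) * (Y * Y ^ m)             ≤⟨ m≤m+n _ (m * Y ^ m) ⟩
  (Y + suc m) * (Y * Y ^ m) + m * Y ^ m ≡⟨ expand Y m (Y ^ m) ⟩
  suc Y * ((Y + m) * Y ^ m)             ≤⟨ *-monoʳ-≤ (suc Y) (bernoulli Y m) ⟩
  suc Y * (Y * suc Y ^ m)               ≡⟨ x*yz≡y*xz (suc Y) Y (suc Y ^ m) ⟩
  Y * (suc Y * suc Y ^ m)               ∎
  where
  open ≤-Reasoning
  expand : ∀ Y m p → (Y + suc m) * (Y * p) + m * p ≡ suc Y * ((Y + m) * p)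
  expand = solve-∀

2*n^n≤[1+n]^n : ∀ n .{{_ : NonZero n}} → 2 * n ^ n ≤ suc n ^ n
2*n^n≤[1+n]^n n = *-cancelˡ-≤ n (begin
  n * (2 * n ^ n) ≡⟨ double n (n ^ n) ⟩
  (n + n) * n ^ n ≤⟨ bernoulli n n ⟩
  n * suc n ^ n   ∎)
  where
  open ≤-Reasoning
  double : ∀ n p → n * (2 * p) ≡ (n + n) * p
  double = solve-∀

-- With X = Y + 1 this is (1 - 1/X)^K ≥ 1 - K/X, cleared of denominators and of subtraction.
bernoulli-reverse : ∀ Y K → suc Y * suc Y ^ K ≤ suc Y * Y ^ K + K * suc Y ^ K
bernoulli-reverse Y zero = m≤m+n _ _
bernoulli-reverse Y (suc K) = begin
  X * (X * X ^ K)                              ≡⟨ split Y (X ^ K) ⟩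
  Y * (X * X ^ K) + X * X ^ K                  ≤⟨ +-monoˡ-≤ _ (*-monoʳ-≤ Y (bernoulli-reverse Y K)) ⟩
  Y * (X * Y ^ K + K * X ^ K) + X * X ^ K      ≤⟨ m≤m+n _ (K * X ^ K) ⟩
  Y * (X * Y ^ K + K * X ^ K) + X * X ^ K + K * X ^ K ≡⟨ collect Y K (Y ^ K) (X ^ K) ⟩
  X * (Y * Y ^ K) + suc K * (X * X ^ K)        ∎
  where
  open ≤-Reasoning
  X = suc Y
  split : ∀ Y p → suc Y * (suc Y * p) ≡ Y * (suc Y * p) + suc Y * p
  split = solve-∀
  collect : ∀ Y K q p → Y * (suc Y * q + K * p) + suc Y * p + K * p
                      ≡ suc Y * (Y * q) + suc K * (suc Y * p)
  collect = solve-∀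

-- (1 + 1/Y)ᴷ ≤ 1 + 1/M, cleared of denominators.
bernoulli-ratio : ∀ M Y K → K * suc M ≤ suc Y → suc Y ^ K * M ≤ suc M * Y ^ K
bernoulli-ratio M Y K K[1+M]≤1+Y = *-cancelˡ-≤ X (+-cancelʳ-≤ (X * X ^ K) _ _ (begin
  X * (X ^ K * M) + X * X ^ K            ≡⟨ factor X (X ^ K) M ⟩
  suc M * (X * X ^ K)                    ≤⟨ *-monoʳ-≤ (suc M) (bernoulli-reverse Y K) ⟩
  suc M * (X * Y ^ K + K * X ^ K)        ≡⟨ expand M X K (Y ^ K) (X ^ K) ⟩
  X * (suc M * Y ^ K) + K * suc M * X ^ K ≤⟨ +-monoʳ-≤ (X * (suc M * Y ^ K)) (*-monoˡ-≤ (X ^ K) K[1+M]≤1+Y) ⟩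
  X * (suc M * Y ^ K) + X * X ^ K        ∎))
  where
  open ≤-Reasoning
  X = suc Y
  factor : ∀ X p M → X * (p * M) + X * p ≡ suc M * (X * p)
  factor = solve-∀
  expand : ∀ M X K q p → suc M * (X * q + K * p) ≡ X * (suc M * q) + K * suc M * p
  expand = solve-∀

-- `bernoulli-ratio` trades K factors 1 + 1/Y for one factor 1 + 1/M, so a bound (1 + 1/Y)^h on A/B
-- becomes (1 + 1/M)^y.
ratio-coarsen : ∀ M Y .{{_ : NonZero Y}} K y {h A B} → K * suc M ≤ suc Y → h ≤ K * y →
                A * Y ^ h ≤ suc Y ^ h * B → A * M ^ y ≤ suc M ^ y * B
ratio-coarsen M Y K y {h} {A} {B} K[1+M]≤1+Y h≤Ky A≤B = *-cancelˡ-≤ (Y ^ h * Y ^ d) {{nz}} (begin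
  Y ^ h * Y ^ d * (A * M ^ y)      ≡⟨ shuffle₁ (Y ^ h) (Y ^ d) A (M ^ y) ⟩
  (A * Y ^ h) * Y ^ d * M ^ y      ≤⟨ *-monoˡ-≤ (M ^ y) (*-mono-≤ A≤B (^-monoˡ-≤ d (n≤1+n Y))) ⟩
  (suc Y ^ h * B) * suc Y ^ d * M ^ y ≡⟨ shuffle₂ (suc Y ^ h) B (suc Y ^ d) (M ^ y) ⟩
  (suc Y ^ h * suc Y ^ d) * M ^ y * B ≡⟨ cong (λ z → z * M ^ y * B) (power (suc Y)) ⟩
  (suc Y ^ K) ^ y * M ^ y * B      ≡⟨ cong (_* B) (sym (^-distribʳ-* y (suc Y ^ K) M)) ⟩
  (suc Y ^ K * M) ^ y * B          ≤⟨ *-monoˡ-≤ B (^-monoˡ-≤ y (bernoulli-ratio M Y K K[1+M]≤1+Y)) ⟩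
  (suc M * Y ^ K) ^ y * B          ≡⟨ cong (_* B) (^-distribʳ-* y (suc M) (Y ^ K)) ⟩
  suc M ^ y * (Y ^ K) ^ y * B      ≡⟨ cong (λ z → suc M ^ y * z * B) (sym (power Y)) ⟩
  suc M ^ y * (Y ^ h * Y ^ d) * B  ≡⟨ shuffle₃ (suc M ^ y) (Y ^ h * Y ^ d) B ⟩
  Y ^ h * Y ^ d * (suc M ^ y * B)  ∎)
  where
  open ≤-Reasoning
  -- Pads the exponent h to the exact multiple K * y; the extra factors only weaken the bound.
  d = proj₁ (m≤n⇒∃[o]m+o≡n h≤Ky)
  h+d≡Ky : h + d ≡ K * y
  h+d≡Ky = proj₂ (m≤n⇒∃[o]m+o≡n h≤Ky)
  power : ∀ Z → Z ^ h * Z ^ d ≡ (Z ^ K) ^ y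
  power Z = trans (sym (^-distribˡ-+-* Z h d))
              (trans (cong (Z ^_) h+d≡Ky) (sym (^-*-assoc Z K y)))
  nz : NonZero (Y ^ h * Y ^ d)
  nz = m*n≢0 (Y ^ h) (Y ^ d) {{m^n≢0 Y h}} {{m^n≢0 Y d}}
  shuffle₁ : ∀ p q a m → p * q * (a * m) ≡ (a * p) * q * m
  shuffle₁ = solve-∀
  shuffle₂ : ∀ p b q m → (p * b) * q * m ≡ (p * q) * m * b
  shuffle₂ = solve-∀
  shuffle₃ : ∀ p q b → p * q * b ≡ q * (p * b)
  shuffle₃ = solve-∀

-- Finite sums

∑ : ∀ {a} {A : Set a} → List A → (A → ℕ) → ℕ
∑ []       f = 0
∑ (x ∷ xs) f = f x + ∑ xs f

module _ {a} {A : Set a} where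

  ∑-mono : ∀ (xs : List A) {f g} → (∀ x → f x ≤ g x) → ∑ xs f ≤ ∑ xs g
  ∑-mono []       f≤g = z≤n
  ∑-mono (x ∷ xs) f≤g = +-mono-≤ (f≤g x) (∑-mono xs f≤g)

  ∑-+ : ∀ (xs : List A) f g → ∑ xs (λ x → f x + g x) ≡ ∑ xs f + ∑ xs g
  ∑-+ []       f g = refl
  ∑-+ (x ∷ xs) f g =
    trans (cong (f x + g x +_) (∑-+ xs f g)) (+-exchange (f x) (g x) (∑ xs f) (∑ xs g))

  ∑-*ˡ : ∀ (xs : List A) c f → ∑ xs (λ x → c * f x) ≡ c * ∑ xs f
  ∑-*ˡ []       c f = sym (*-zeroʳ c)
  ∑-*ˡ (x ∷ xs) c f =
    trans (cong (c * f x +_) (∑-*ˡ xs c f)) (sym (*-distribˡ-+ c (f x) (∑ xs f)))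

  ∑-const : ∀ (xs : List A) c → ∑ xs (λ _ → c) ≡ length xs * c
  ∑-const []       c = refl
  ∑-const (x ∷ xs) c = cong (c +_) (∑-const xs c)

  ∑-bound : ∀ (xs : List A) {f} c → (∀ x → f x ≤ c) → ∑ xs f ≤ length xs * c
  ∑-bound xs c f≤c = ≤-trans (∑-mono xs f≤c) (≤-reflexive (∑-const xs c))

  ∈⇒≤∑ : ∀ {xs : List A} {x} f → x ∈ xs → f x ≤ ∑ xs f
  ∈⇒≤∑ f (here refl) = m≤m+n _ _
  ∈⇒≤∑ f (there x∈xs) = ≤-trans (∈⇒≤∑ f x∈xs) (m≤n+m _ _)

  ∑-++ : ∀ (xs ys : List A) f → ∑ (xs ++ ys) f ≡ ∑ xs f + ∑ ys f
  ∑-++ []       ys f = refl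
  ∑-++ (x ∷ xs) ys f = trans (cong (f x +_) (∑-++ xs ys f)) (sym (+-assoc (f x) _ _))

∑-map : ∀ {a b} {A : Set a} {B : Set b} (g : A → B) xs f → ∑ (map g xs) f ≡ ∑ xs (f ∘ g)
∑-map g []       f = refl
∑-map g (x ∷ xs) f = cong (f (g x) +_) (∑-map g xs f)

∑-comm : ∀ {a b} {A : Set a} {B : Set b} (xs : List A) (ys : List B) (f : A → B → ℕ) →
         ∑ xs (λ x → ∑ ys (f x)) ≡ ∑ ys (λ y → ∑ xs (λ x → f x y))
∑-comm []       ys f = sym (trans (∑-const ys 0) (*-zeroʳ (length ys)))
∑-comm (x ∷ xs) ys f =
  trans (cong (∑ ys (f x) +_) (∑-comm xs ys f)) (sym (∑-+ ys (f x) _))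

∑-cartesianProductWith : ∀ {a b c} {A : Set a} {B : Set b} {C : Set c} (g : A → B → C) xs ys f →
  ∑ (cartesianProductWith g xs ys) f ≡ ∑ xs (λ x → ∑ ys (λ y → f (g x y)))
∑-cartesianProductWith g []       ys f = refl
∑-cartesianProductWith g (x ∷ xs) ys f =
  trans (∑-++ (map (g x) ys) _ f)
        (cong₂ _+_ (∑-map (g x) ys f) (∑-cartesianProductWith g xs ys f))

δ : ∀ {n} → Fin n → Fin n → ℕ
δ x y = if does (x Fin.≟ y) then 1 else 0

δ-refl : ∀ {n} (x : Fin n) → δ x x ≡ 1
δ-refl x with x Fin.≟ x
... | yes _  = refl
... | no x≢x = contradiction refl x≢x

δ-≢ : ∀ {n} {x y : Fin n} → x ≢ y → δ x y ≡ 0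
δ-≢ {x = x} {y} x≢y with x Fin.≟ y
... | yes x≡y = contradiction x≡y x≢y
... | no _    = refl

∑δ≤1 : ∀ {n} {xs : List (Fin n)} z → Unique xs → ∑ xs (λ x → δ x z) ≤ 1
∑δ≤1 z [] = z≤n
∑δ≤1 {xs = x ∷ xs} z (x∉xs ∷ u) with x Fin.≟ z
... | no _     = ∑δ≤1 z u
... | yes refl = s≤s (≤-reflexive (vanish xs x∉xs))
  where
  vanish : ∀ ys → All (x ≢_) ys → ∑ ys (λ y → δ y x) ≡ 0
  vanish []       []            = refl
  vanish (y ∷ ys) (x≢y ∷ x∉ys) = cong₂ _+_ (δ-≢ (x≢y ∘ sym)) (vanish ys x∉ys)

-- Weighted sums over bit vectors

-- The product measure with odds 1 : M for every bit to be set, scaled by (M + 1)ᵉ.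
weigh : ℕ → ∀ {e} → (Vec Bool e → ℕ) → ℕ
weigh M {zero}  h = h []
weigh M {suc e} h = M * weigh M (h ∘ (false ∷_)) + weigh M (h ∘ (true ∷_))

module _ (M : ℕ) where

  weigh-mono : ∀ {e} {h k : Vec Bool e → ℕ} → (∀ ω → h ω ≤ k ω) → weigh M h ≤ weigh M k
  weigh-mono {zero}  h≤k = h≤k []
  weigh-mono {suc e} h≤k =
    +-mono-≤ (*-monoʳ-≤ M (weigh-mono (h≤k ∘ (false ∷_)))) (weigh-mono (h≤k ∘ (true ∷_)))

  weigh-+ : ∀ {e} (h k : Vec Bool e → ℕ) → weigh M (λ ω → h ω + k ω) ≡ weigh M h + weigh M k
  weigh-+ {zero}  h k = refl
  weigh-+ {suc e} h k =
    trans (cong₂ (λ x y → M * x + y) (weigh-+ (h ∘ (false ∷_)) (k ∘ (false ∷_)))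
                                       (weigh-+ (h ∘ (true ∷_)) (k ∘ (true ∷_))))
          (regroup M _ _ _ _)
    where
    regroup : ∀ m a b c d → m * (a + b) + (c + d) ≡ (m * a + c) + (m * b + d)
    regroup = solve-∀

  weigh-*ˡ : ∀ {e} c (h : Vec Bool e → ℕ) → weigh M (λ ω → c * h ω) ≡ c * weigh M h
  weigh-*ˡ {zero}  c h = refl
  weigh-*ˡ {suc e} c h =
    trans (cong₂ (λ x y → M * x + y) (weigh-*ˡ c (h ∘ (false ∷_)))
                                       (weigh-*ˡ c (h ∘ (true ∷_))))
          (regroup M c _ _)
    where
    regroup : ∀ m c a b → m * (c * a) + c * b ≡ c * (m * a + b)
    regroup = solve-∀

  weigh-0 : ∀ {e} → weigh M {e} (λ _ → 0) ≡ 0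
  weigh-0 {zero}  = refl
  weigh-0 {suc e} rewrite weigh-0 {e} = trans (+-identityʳ _) (*-zeroʳ M)

  weigh-1 : ∀ {e} → weigh M {e} (λ _ → 1) ≡ suc M ^ e
  weigh-1 {zero}  = refl
  weigh-1 {suc e} rewrite weigh-1 {e} = +-comm (M * suc M ^ e) (suc M ^ e)

  weigh-∑ : ∀ {e a} {A : Set a} (xs : List A) (h : A → Vec Bool e → ℕ) →
            weigh M (λ ω → ∑ xs (λ x → h x ω)) ≡ ∑ xs (λ x → weigh M (h x))
  weigh-∑ {e} []   h = weigh-0 {e}
  weigh-∑ (x ∷ xs) h = trans (weigh-+ (h x) _) (cong (weigh M (h x) +_) (weigh-∑ xs h))

  -- First moment method; with `k` constantly 1 it yields a vector on which the count `h` vanishes.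
  averaging : ∀ {e} {h k : Vec Bool e → ℕ} → weigh M h < weigh M k → ∃ λ ω → h ω < k ω
  averaging {zero}  h<k = [] , h<k
  averaging {suc e} {h} {k} h<k
    with weigh M (h ∘ (false ∷_)) <? weigh M (k ∘ (false ∷_))
       | weigh M (h ∘ (true ∷_)) <? weigh M (k ∘ (true ∷_))
  ... | yes h₀<k₀ | _         = let ω , p = averaging h₀<k₀ in false ∷ ω , p
  ... | no _      | yes h₁<k₁ = let ω , p = averaging h₁<k₁ in true ∷ ω , p
  ... | no h₀≮k₀  | no h₁≮k₁  =
    contradiction h<k (≤⇒≯ (+-mono-≤ (*-monoʳ-≤ M (≮⇒≥ h₀≮k₀)) (≮⇒≥ h₁≮k₁)))

  -- Clearing a set bit multiplies the weight by M.
  weigh-clear : ∀ {e} (i : Fin e) h →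
    M * weigh M (λ ω → if lookup ω i then h (ω [ i ]≔ false) else 0) ≤ weigh M h
  weigh-clear {suc e} zero h = ≤-trans (≤-reflexive (begin-equality
    M * (M * weigh M {e} (λ _ → 0) + W) ≡⟨ cong (λ z → M * (M * z + W)) (weigh-0 {e}) ⟩
    M * (M * 0 + W)                 ≡⟨ cong (λ z → M * (z + W)) (*-zeroʳ M) ⟩
    M * W                           ∎)) (m≤m+n _ _)
    where
    open ≤-Reasoning
    W = weigh M (h ∘ (false ∷_))
  weigh-clear (suc i) h = ≤-trans (≤-reflexive (regroup M _ _))
    (+-mono-≤ (*-monoʳ-≤ M (weigh-clear i (h ∘ (false ∷_)))) (weigh-clear i (h ∘ (true ∷_))))
    where
    regroup : ∀ m a b → m * (m * a + b) ≡ m * (m * a) + m * b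
    regroup = solve-∀

  -- As `h` is no smaller with bit `i` set than with it cleared, the vectors with the bit set carry
  -- at least the share 1/(M + 1) of the weight, and this share is lost.
  weigh-absent : ∀ {e} (i : Fin e) h → (∀ ω → h (ω [ i ]≔ false) ≤ h (ω [ i ]≔ true)) →
    suc M * weigh M (λ ω → if lookup ω i then 0 else h ω) ≤ M * weigh M h
  weigh-absent {suc e} zero h h₀≤h₁ rewrite weigh-0 {e} = begin
    suc M * (M * W₀ + 0) ≡⟨ regroup M W₀ ⟩
    M * (M * W₀ + W₀)    ≤⟨ *-monoʳ-≤ M (+-monoʳ-≤ (M * W₀) (weigh-mono λ ω → h₀≤h₁ (false ∷ ω))) ⟩
    M * (M * W₀ + weigh M (h ∘ (true ∷_))) ∎
    where
    open ≤-Reasoning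
    W₀ = weigh M (h ∘ (false ∷_))
    regroup : ∀ m a → suc m * (m * a + 0) ≡ m * (m * a + a)
    regroup = solve-∀
  weigh-absent (suc i) h h₀≤h₁ = ≤-trans (≤-reflexive (regroup M (suc M) _ _))
    (≤-trans (+-mono-≤ (*-monoʳ-≤ M (weigh-absent i (h ∘ (false ∷_)) (h₀≤h₁ ∘ (false ∷_))))
                       (weigh-absent i (h ∘ (true ∷_)) (h₀≤h₁ ∘ (true ∷_))))
             (≤-reflexive (sym (regroup M M _ _))))
    where
    regroup : ∀ m s a b → s * (m * a + b) ≡ m * (s * a) + s * b
    regroup = solve-∀

-- Greedy deletion

_⊆_ : ∀ {e} → Vec Bool e → Vec Bool e → Set
ω ⊆ ω′ = ∀ i → lookup ω i ≡ true → lookup ω′ i ≡ true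

module _ {e : ℕ} where

  cleared-true : ∀ (ω : Vec Bool e) {i} j → lookup (ω [ i ]≔ false) j ≡ true →
                 j ≢ i × lookup ω j ≡ true
  cleared-true ω {i} j eq with j Fin.≟ i
  ... | yes refl = contradiction (trans (sym (lookup∘update i ω false)) eq) λ ()
  ... | no j≢i   = j≢i , trans (sym (lookup∘update′ j≢i ω false)) eq

  true-cleared : ∀ (ω : Vec Bool e) {i j} → j ≢ i → lookup ω j ≡ true →
                 lookup (ω [ i ]≔ false) j ≡ true
  true-cleared ω j≢i eq = trans (lookup∘update′ j≢i ω false) eq

  -- A repeated index is already cleared at its second visit, so a list with repetitions always
  -- yields `nothing`.
  extract : List (Fin e) → Vec Bool e → Maybe (Vec Bool e)
  extract []      ω = just ω
  extract (i ∷ c) ω = if lookup ω i then extract c (ω [ i ]≔ false) else nothing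

  -- Taking out all edges of a copy, not just one, makes the successive deletions edge-disjoint, and
  -- their union is everything that is lost.
  strip : List (List (Fin e)) → Vec Bool e → Vec Bool e
  strip []      ω = ω
  strip (c ∷ L) ω = strip L (fromMaybe ω (extract c ω))

  extract-⊆ : ∀ c {ω ω₁} → extract c ω ≡ just ω₁ → ω₁ ⊆ ω
  extract-⊆ []      refl j p = p
  extract-⊆ (i ∷ c) {ω} eq j p with lookup ω i
  ... | true  = proj₂ (cleared-true ω j (extract-⊆ c eq j p))
  ... | false with () ← eq

  extract-clears : ∀ i c {ω ω₁} → extract (i ∷ c) ω ≡ just ω₁ → lookup ω₁ i ≢ true
  extract-clears i c {ω} eq p with lookup ω i
  ... | true  = proj₁ (cleared-true ω i (extract-⊆ c eq i p)) refl
  ... | false with () ← eq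

  extract-succeeds : ∀ c ω → Unique c → All (λ i → lookup ω i ≡ true) c → extract c ω ≢ nothing
  extract-succeeds []      ω u         ps       ()
  extract-succeeds (i ∷ c) ω (i∉c ∷ u) (p ∷ ps) eq rewrite p =
    extract-succeeds c (ω [ i ]≔ false) u
      (All.zipWith (λ (i≢j , q) → true-cleared ω (i≢j ∘ sym) q) (i∉c , ps)) eq

  step-⊆ : ∀ c ω → fromMaybe ω (extract c ω) ⊆ ω
  step-⊆ c ω i p with extract c ω in eq
  ... | nothing = p
  ... | just ω₁ = extract-⊆ c eq i p

  strip-⊆ : ∀ L ω → strip L ω ⊆ ω
  strip-⊆ []      ω i p = p
  strip-⊆ (c ∷ L) ω i p = step-⊆ c ω i (strip-⊆ L _ i p)

  -- Bits never come back, so a copy complete at the end was complete at its turn; then `extract`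
  -- succeeded and cleared its head.
  strip-free : ∀ {i c L} ω → (i ∷ c) ∈ L → Unique (i ∷ c) →
               ¬ All (λ j → lookup (strip L ω) j ≡ true) (i ∷ c)
  strip-free {i} {c} {_ ∷ L} ω (here refl) u ps with extract (i ∷ c) ω in eq
  ... | nothing = extract-succeeds (i ∷ c) ω u (All.map (strip-⊆ L ω _) ps) eq
  ... | just ω₁ = extract-clears i c eq (strip-⊆ L ω₁ i (All.head ps))
  strip-free {L = c′ ∷ L} ω (there c∈L) u ps = strip-free (fromMaybe ω (extract c′ ω)) c∈L u ps

  -- Counting incidences instead of testing for one overestimates, but it turns the number of copies
  -- meeting `Z` into a multiple sum whose order can be exchanged.
  multiplicity : List (Fin e) → List (Fin e) → ℕ
  multiplicity Z c = ∑ c (λ i → ∑ Z (λ z → δ i z))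

  multiplicity-0 : ∀ {Z c} → multiplicity Z c ≡ 0 → ∀ {i} → i ∈ c → i ∉ Z
  multiplicity-0 {Z} {c} eq {i} i∈c i∈Z = contradiction (begin
    1                ≡⟨ sym (δ-refl i) ⟩
    δ i i            ≤⟨ ∈⇒≤∑ (δ i) i∈Z ⟩
    ∑ Z (δ i)        ≤⟨ ∈⇒≤∑ (λ j → ∑ Z (δ j)) i∈c ⟩
    multiplicity Z c ≡⟨ eq ⟩
    0                ∎) λ ()
    where open ≤-Reasoning

  -- This is `h` evaluated after `extract`, with 0 for failure; the recursion over single bits is
  -- the shape to which `weigh-clear` applies.
  removed : List (Fin e) → (Vec Bool e → ℕ) → Vec Bool e → ℕ
  removed []      h ω = h ω
  removed (i ∷ c) h ω = if lookup ω i then removed c h (ω [ i ]≔ false) else 0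

  absent : List (Fin e) → Vec Bool e → ℕ
  absent []      ω = 1
  absent (z ∷ Z) ω = if lookup ω z then 0 else absent Z ω

  -- Counts the ways to choose members of L meeting Z that can be extracted one after the
  -- other so that no bit of Z is left, each weighted by its multiplicities.
  certificates : List (Fin e) → List (List (Fin e)) → Vec Bool e → ℕ
  certificates Z []      ω = absent Z ω
  certificates Z (c ∷ L) ω =
    certificates Z L ω + multiplicity Z c * removed c (certificates Z L) ω

  removed-extract : ∀ c {h ω ω₁} → extract c ω ≡ just ω₁ → removed c h ω ≡ h ω₁
  removed-extract []      refl = refl
  removed-extract (i ∷ c) {ω = ω} eq with lookup ω i
  ... | true = removed-extract c eq
  ... | false with () ← eq

  absent-true : ∀ Z ω → (∀ {z} → z ∈ Z → lookup ω z ≢ true) → absent Z ω ≡ 1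
  absent-true []      ω off = refl
  absent-true (z ∷ Z) ω off with lookup ω z in eq
  ... | true  = contradiction eq (off (here refl))
  ... | false = absent-true Z ω (off ∘ there)

  absent-update : ∀ Z ω {i b} → i ∉ Z → absent Z (ω [ i ]≔ b) ≡ absent Z ω
  absent-update []      ω i∉Z = refl
  absent-update (z ∷ Z) ω {i} {b} i∉Z
    rewrite lookup∘update′ {i = z} {j = i} (λ z≡i → i∉Z (here (sym z≡i))) ω b
          | absent-update Z ω {i} {b} (i∉Z ∘ there) = refl

  -- Here `ω` is the true state of the scan and `ω′` the state when deletions missing `Z` are
  -- skipped: more bits may survive in `ω′`, but none of them in `Z`.
  record Agree (Z : List (Fin e)) (ω ω′ : Vec Bool e) : Set where
    constructor agree
    field
      below : ω ⊆ ω′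
      on    : ∀ {z} → z ∈ Z → lookup ω′ z ≡ true → lookup ω z ≡ true

  extract-both : ∀ {Z} c {ω ω₁ ω′} → Agree Z ω ω′ → extract c ω ≡ just ω₁ →
                 ∃ λ ω₁′ → extract c ω′ ≡ just ω₁′ × Agree Z ω₁ ω₁′
  extract-both []      a refl = _ , refl , a
  extract-both (i ∷ c) {ω} {ω′ = ω′} (agree below on) eq with lookup ω i in ωᵢ
  ... | false with () ← eq
  ... | true rewrite below i ωᵢ = extract-both c (agree
    (λ j p → let j≢i , q = cleared-true ω j p in true-cleared ω′ j≢i (below j q))
    (λ {j} j∈Z p → let j≢i , q = cleared-true ω′ j p in true-cleared ω j≢i (on j∈Z q))) eq

  extract-left : ∀ {Z} c {ω ω₁ ω′} → (∀ {i} → i ∈ c → i ∉ Z) → Agree Z ω ω′ →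
                 extract c ω ≡ just ω₁ → Agree Z ω₁ ω′
  extract-left []      off a refl = a
  extract-left (i ∷ c) {ω} off (agree below on) eq with lookup ω i
  ... | false with () ← eq
  ... | true = extract-left c (off ∘ there) (agree
    (λ j p → below j (proj₂ (cleared-true ω j p)))
    (λ {j} j∈Z p → true-cleared ω (λ { refl → off (here refl) j∈Z }) (on j∈Z p))) eq

  -- Deletions that miss Z can be skipped, which is why certificates ignores them.
  certificates-positive : ∀ Z L ω {ω′} → Agree Z ω ω′ →
    (∀ {z} → z ∈ Z → lookup (strip L ω) z ≢ true) → 1 ≤ certificates Z L ω′
  certificates-positive Z []      ω (agree _ on) off =
    ≤-reflexive (sym (absent-true Z _ (λ z∈Z p → off z∈Z (on z∈Z p))))
  certificates-positive Z (c ∷ L) ω {ω′} a off with extract c ω in eq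
  ... | nothing = ≤-trans (certificates-positive Z L ω a off) (m≤m+n _ _)
  ... | just ω₁ with multiplicity Z c in mult
  ...   | zero  = ≤-trans
    (certificates-positive Z L ω₁ (extract-left c (multiplicity-0 {Z} mult) a eq) off) (m≤m+n _ _)
  ...   | suc m = let ω₁′ , eq′ , a′ = extract-both c a eq in begin
    1                                      ≤⟨ certificates-positive Z L ω₁ a′ off ⟩
    certificates Z L ω₁′                   ≡⟨ sym (removed-extract c eq′) ⟩
    removed c (certificates Z L) ω′        ≤⟨ m≤m+n _ _ ⟩
    suc m * removed c (certificates Z L) ω′ ≤⟨ m≤n+m _ (certificates Z L ω′) ⟩
    certificates Z L ω′ + suc m * removed c (certificates Z L) ω′ ∎
    where open ≤-Reasoning

  module _ (M : ℕ) where

    -- The injection that empties a copy, performed bit by bit; every bit contributes one factor M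
    -- through `weigh-clear`.
    weigh-removed : ∀ c h → M ^ length c * weigh M (removed c h) ≤ weigh M h
    weigh-removed []      h = ≤-reflexive (*-identityˡ _)
    weigh-removed (i ∷ c) h = begin
      M * M ^ length c * W   ≡⟨ xy*z≡y*xz M (M ^ length c) W ⟩
      M ^ length c * (M * W) ≤⟨ *-monoʳ-≤ (M ^ length c) (weigh-clear M i (removed c h)) ⟩
      M ^ length c * weigh M (removed c h) ≤⟨ weigh-removed c h ⟩
      weigh M h              ∎
      where
      open ≤-Reasoning
      W = weigh M (removed (i ∷ c) h)

    -- Distinct bits are independent, which gives the probability (1 - 1/(M + 1))^|Z|.
    weigh-absent-all : ∀ {Z} → Unique Z →
      suc M ^ length Z * weigh M (absent Z) ≤ M ^ length Z * suc M ^ e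
    weigh-absent-all [] = *-monoʳ-≤ 1 (≤-reflexive (weigh-1 M {e}))
    weigh-absent-all {z ∷ Z} (z∉Z ∷ u) = begin
      suc M * suc M ^ l * W               ≡⟨ xy*z≡y*xz (suc M) (suc M ^ l) W ⟩
      suc M ^ l * (suc M * W)             ≤⟨ *-monoʳ-≤ (suc M ^ l) (weigh-absent M z (absent Z) indep) ⟩
      suc M ^ l * (M * weigh M (absent Z)) ≡⟨ x*yz≡y*xz (suc M ^ l) M _ ⟩
      M * (suc M ^ l * weigh M (absent Z)) ≤⟨ *-monoʳ-≤ M (weigh-absent-all u) ⟩
      M * (M ^ l * suc M ^ e)             ≡⟨ sym (*-assoc M (M ^ l) _) ⟩
      M * M ^ l * suc M ^ e               ∎
      where
      open ≤-Reasoning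
      l = length Z
      W = weigh M (absent (z ∷ Z))
      z∉ : z ∉ Z
      z∉ z∈Z = All.lookup z∉Z z∈Z refl
      indep : ∀ ω → absent Z (ω [ z ]≔ false) ≤ absent Z (ω [ z ]≔ true)
      indep ω = ≤-reflexive (trans (absent-update Z ω z∉) (sym (absent-update Z ω z∉)))

    -- With Y = M^l, a list of multiplicity μ multiplies the weight by at most 1 + μ/Y, hence by at
    -- most (1 + 1/Y)^μ. The tail `L′` lets the two patterns, whose copies differ in length, be
    -- peeled off separately.
    weigh-certificates-++ : .{{_ : NonZero M}} → ∀ Z l L {L′} → All (λ c → length c ≡ l) L →
      let m = ∑ L (multiplicity Z) in
      weigh M (certificates Z (L ++ L′)) * (M ^ l) ^ m ≤ suc (M ^ l) ^ m * weigh M (certificates Z L′)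
    weigh-certificates-++ Z l []      []          = ≤-reflexive (*-comm _ 1)
    weigh-certificates-++ Z _ (c ∷ L) {L′} (refl ∷ eqs) = *-cancelˡ-≤ Y {{m^n≢0 M (length c)}} (begin
      Y * (weigh M (certificates Z (c ∷ L ++ L′)) * Y ^ (μ + m))
        ≡⟨ cong₂ (λ x y → Y * (x * y)) expand (^-distribˡ-+-* Y μ m) ⟩
      Y * ((A + μ * R) * (Y ^ μ * Y ^ m))       ≡⟨ shuffle₁ Y A μ R (Y ^ μ) (Y ^ m) ⟩
      (Y * A + μ * (Y * R)) * (Y ^ μ * Y ^ m)
        ≤⟨ *-monoˡ-≤ _ (+-monoʳ-≤ (Y * A) (*-monoʳ-≤ μ (weigh-removed c _))) ⟩
      (Y * A + μ * A) * (Y ^ μ * Y ^ m)         ≡⟨ shuffle₂ Y A μ (Y ^ μ) (Y ^ m) ⟩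
      (Y + μ) * Y ^ μ * (A * Y ^ m)             ≤⟨ *-mono-≤ (bernoulli Y μ) (weigh-certificates-++ Z _ L eqs) ⟩
      Y * suc Y ^ μ * (suc Y ^ m * B)           ≡⟨ shuffle₃ Y (suc Y ^ μ) (suc Y ^ m) B ⟩
      Y * ((suc Y ^ μ * suc Y ^ m) * B)         ≡⟨ cong (λ z → Y * (z * B)) (sym (^-distribˡ-+-* (suc Y) μ m)) ⟩
      Y * (suc Y ^ (μ + m) * B)                 ∎)
      where
      open ≤-Reasoning
      Y = M ^ length c
      μ = multiplicity Z c
      m = ∑ L (multiplicity Z)
      A = weigh M (certificates Z (L ++ L′))
      R = weigh M (removed c (certificates Z (L ++ L′)))
      B = weigh M (certificates Z L′)
      expand : weigh M (certificates Z (c ∷ L ++ L′)) ≡ A + μ * R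
      expand = trans (weigh-+ M (certificates Z (L ++ L′)) _)
                     (cong (A +_) (weigh-*ˡ M μ (removed c (certificates Z (L ++ L′)))))
      shuffle₁ : ∀ y a μ r p q → y * ((a + μ * r) * (p * q)) ≡ (y * a + μ * (y * r)) * (p * q)
      shuffle₁ = solve-∀
      shuffle₂ : ∀ y a μ p q → (y * a + μ * a) * (p * q) ≡ (y + μ) * p * (a * q)
      shuffle₂ = solve-∀
      shuffle₃ : ∀ y p q b → y * p * (q * b) ≡ y * ((p * q) * b)
      shuffle₃ = solve-∀

-- Copies of a pattern

vectors : ∀ n k → List (Vec (Fin n) k)
vectors n zero    = [] ∷ []
vectors n (suc k) = cartesianProductWith _∷_ (allFin n) (vectors n k)

∈-vectors : ∀ {n k} (τ : Vec (Fin n) k) → τ ∈ vectors n k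
∈-vectors []      = here refl
∈-vectors (x ∷ τ) = ∈-cartesianProductWith⁺ _∷_ (∈-allFin x) (∈-vectors τ)

length-allFin : ∀ n → length (allFin n) ≡ n
length-allFin n = length-tabulate {n = n} _

length-cartesianProductWith : ∀ {a b c} {A : Set a} {B : Set b} {C : Set c} (f : A → B → C) xs ys →
  length (cartesianProductWith f xs ys) ≡ length xs * length ys
length-cartesianProductWith f []       ys = refl
length-cartesianProductWith f (x ∷ xs) ys = trans (length-++ (map (f x) ys))
  (cong₂ _+_ (length-map (f x) ys) (length-cartesianProductWith f xs ys))

length-vectors : ∀ n k → length (vectors n k) ≡ n ^ k
length-vectors n zero    = refl
length-vectors n (suc k) = trans (length-cartesianProductWith _∷_ (allFin n) (vectors n k))
  (cong₂ _*_ (length-allFin n) (length-vectors n k))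

∑-coordinate : ∀ n k (i : Fin (suc k)) (φ : Fin n → ℕ) →
  ∑ (vectors n (suc k)) (λ τ → φ (lookup τ i)) ≡ n ^ k * ∑ (allFin n) φ
∑-coordinate n k zero φ = begin
  ∑ (vectors n (suc k)) (λ τ → φ (lookup τ zero)) ≡⟨ ∑-cartesianProductWith _∷_ (allFin n) (vectors n k) _ ⟩
  ∑ (allFin n) (λ x → ∑ (vectors n k) (λ _ → φ x)) ≡⟨ ∑-comm (allFin n) (vectors n k) _ ⟩
  ∑ (vectors n k) (λ _ → ∑ (allFin n) φ) ≡⟨ ∑-const (vectors n k) _ ⟩
  length (vectors n k) * ∑ (allFin n) φ ≡⟨ cong (_* ∑ (allFin n) φ) (length-vectors n k) ⟩
  n ^ k * ∑ (allFin n) φ ∎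
  where open ≡-Reasoning
∑-coordinate n (suc k) (suc i) φ = begin
  ∑ (vectors n (2 + k)) (λ τ → φ (lookup τ (suc i)))
    ≡⟨ ∑-cartesianProductWith _∷_ (allFin n) (vectors n (suc k)) _ ⟩
  ∑ (allFin n) (λ _ → S) ≡⟨ ∑-const (allFin n) S ⟩
  length (allFin n) * S ≡⟨ cong₂ _*_ (length-allFin n) (∑-coordinate n k i φ) ⟩
  n * (n ^ k * ∑ (allFin n) φ) ≡⟨ sym (*-assoc n (n ^ k) _) ⟩
  n ^ suc k * ∑ (allFin n) φ ∎
  where
  open ≡-Reasoning
  S = ∑ (vectors n (suc k)) (λ τ → φ (lookup τ i))

-- Once two coordinates are fixed, the other k are free. Induction discards coordinates until the
-- first of the two is at the front.
∑-two-coordinates : ∀ n k {i j : Fin (2 + k)} → i Fin.< j → ∀ (φ : Fin n → Fin n → ℕ) b →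
  ∑ (allFin n) (λ x → ∑ (allFin n) (φ x)) ≤ b →
  ∑ (vectors n (2 + k)) (λ τ → φ (lookup τ i) (lookup τ j)) ≤ n ^ k * b
∑-two-coordinates n k {zero} {suc j} _ φ b ∑φ≤b = begin
  ∑ (vectors n (2 + k)) (λ τ → φ (lookup τ zero) (lookup τ (suc j)))
    ≡⟨ ∑-cartesianProductWith _∷_ (allFin n) (vectors n (suc k)) _ ⟩
  ∑ (allFin n) (λ x → ∑ (vectors n (suc k)) (λ τ → φ x (lookup τ j)))
    ≤⟨ ∑-mono (allFin n) (λ x → ≤-reflexive (∑-coordinate n k j (φ x))) ⟩
  ∑ (allFin n) (λ x → n ^ k * ∑ (allFin n) (φ x)) ≡⟨ ∑-*ˡ (allFin n) (n ^ k) _ ⟩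
  n ^ k * ∑ (allFin n) (λ x → ∑ (allFin n) (φ x)) ≤⟨ *-monoʳ-≤ (n ^ k) ∑φ≤b ⟩
  n ^ k * b ∎
  where open ≤-Reasoning
∑-two-coordinates n zero {suc zero} {suc zero} (s≤s ()) φ b ∑φ≤b
∑-two-coordinates n (suc k) {suc i} {suc j} (s≤s i<j) φ b ∑φ≤b = begin
  ∑ (vectors n (3 + k)) (λ τ → φ (lookup τ (suc i)) (lookup τ (suc j)))
    ≡⟨ ∑-cartesianProductWith _∷_ (allFin n) (vectors n (2 + k)) _ ⟩
  ∑ (allFin n) (λ _ → S) ≡⟨ ∑-const (allFin n) S ⟩
  length (allFin n) * S ≡⟨ cong (_* S) (length-allFin n) ⟩
  n * S ≤⟨ *-monoʳ-≤ n (∑-two-coordinates n k i<j φ b ∑φ≤b) ⟩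
  n * (n ^ k * b) ≡⟨ sym (*-assoc n (n ^ k) b) ⟩
  n ^ suc k * b ∎
  where
  open ≤-Reasoning
  S = ∑ (vectors n (2 + k)) (λ τ → φ (lookup τ i) (lookup τ j))

-- Edges are unordered pairs; the bits combine u v with v < u are junk.
pair : ∀ {n} → Fin n → Fin n → Fin (n * n)
pair u v with u Fin.≤? v
... | yes _ = combine u v
... | no _  = combine v u

pair-cases : ∀ {n} (u v : Fin n) → pair u v ≡ combine u v ⊎ pair u v ≡ combine v u
pair-cases u v with u Fin.≤? v
... | yes _ = inj₁ refl
... | no _  = inj₂ refl

pair-sym : ∀ {n} (u v : Fin n) → pair u v ≡ pair v u
pair-sym u v with u Fin.≤? v | v Fin.≤? u
... | yes u≤v | yes v≤u with refl ← Fin.≤-antisym u≤v v≤u = refl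
... | yes u≤v | no v≰u  = refl
... | no u≰v  | yes v≤u = refl
... | no u≰v  | no v≰u  = contradiction (≰⇒≥ u≰v) v≰u

pair-injective : ∀ {n} (u v u′ v′ : Fin n) → pair u v ≡ pair u′ v′ →
                 (u ≡ u′ × v ≡ v′) ⊎ (u ≡ v′ × v ≡ u′)
pair-injective u v u′ v′ eq with pair-cases u v | pair-cases u′ v′
... | inj₁ p | inj₁ q = inj₁ (Fin.combine-injective u v u′ v′ (trans (sym p) (trans eq q)))
... | inj₁ p | inj₂ q = inj₂ (Fin.combine-injective u v v′ u′ (trans (sym p) (trans eq q)))
... | inj₂ p | inj₁ q =
  let v≡ , u≡ = Fin.combine-injective v u u′ v′ (trans (sym p) (trans eq q)) in inj₂ (u≡ , v≡)
... | inj₂ p | inj₂ q =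
  let v≡ , u≡ = Fin.combine-injective v u v′ u′ (trans (sym p) (trans eq q)) in inj₁ (u≡ , v≡)

-- `pair u v` is one of two encodings, each injective on ordered pairs, so each of them hits `z` at
-- most once.
∑-pair : ∀ n (z : Fin (n * n)) → ∑ (allFin n) (λ u → ∑ (allFin n) (λ v → δ (pair u v) z)) ≤ 2
∑-pair n z = begin
  ∑ V (λ u → ∑ V (λ v → δ (pair u v) z))
    ≤⟨ ∑-mono V (λ u → ∑-mono V (λ v → split u v)) ⟩
  ∑ V (λ u → ∑ V (λ v → δ (combine u v) z + δ (combine v u) z))
    ≤⟨ ∑-mono V (λ u → ≤-reflexive (∑-+ V _ _)) ⟩
  ∑ V (λ u → ∑ V (λ v → δ (combine u v) z) + ∑ V (λ v → δ (combine v u) z))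
    ≡⟨ ∑-+ V _ _ ⟩
  ∑ V (λ u → ∑ V (λ v → δ (combine u v) z)) + ∑ V (λ u → ∑ V (λ v → δ (combine v u) z))
    ≤⟨ +-mono-≤
         (once combine (λ eq → Fin.combine-injective _ _ _ _ eq))
         (once (λ u v → combine v u)
               (λ eq → let v≡ , u≡ = Fin.combine-injective _ _ _ _ eq in u≡ , v≡)) ⟩
  2 ∎
  where
  open ≤-Reasoning
  V = allFin n
  split : ∀ u v → δ (pair u v) z ≤ δ (combine u v) z + δ (combine v u) z
  split u v with pair-cases u v
  ... | inj₁ eq rewrite eq = m≤m+n _ _
  ... | inj₂ eq rewrite eq = m≤n+m _ _
  once : (f : Fin n → Fin n → Fin (n * n)) → (∀ {w x y z} → f w y ≡ f x z → w ≡ x × y ≡ z) →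
         ∑ V (λ u → ∑ V (λ v → δ (f u v) z)) ≤ 1
  once f inj = ≤-trans (≤-reflexive (sym (∑-cartesianProductWith f V V (λ x → δ x z))))
    (∑δ≤1 z (cartesianProductWith⁺ f inj (allFin⁺ n) (allFin⁺ n)))

Pattern : ℕ → Set
Pattern k = List (Fin k × Fin k)

-- This orientation excludes loops and the listing of one edge in both directions, so that distinct
-- entries are distinct unordered edges.
Increasing : ∀ {k} → Pattern k → Set
Increasing = All (λ (i , j) → i Fin.< j)

copy : ∀ {n k} → Pattern k → Vec (Fin n) k → List (Fin (n * n))
copy p τ = map (λ (i , j) → pair (lookup τ i) (lookup τ j)) p

-- Noninjective tuples are scanned too: they can only cause more deletions, and the certificates
-- account for those.
copies : ∀ {k} → Pattern k → ∀ n → List (List (Fin (n * n)))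
copies {k} p n = map (copy p) (vectors n k)

copy-unique : ∀ {n k} {p : Pattern k} {τ : Vec (Fin n) k} → Injective _≡_ _≡_ (lookup τ) →
              Increasing p → Unique p → Unique (copy p τ)
copy-unique inj [] [] = []
copy-unique {p = (i , j) ∷ p} {τ} inj (i<j ∷ inc) (ij∉p ∷ u) =
  All.map⁺ (All.zipWith distinct (inc , ij∉p)) ∷ copy-unique {τ = τ} inj inc u
  where
  distinct : ∀ {e} → proj₁ e Fin.< proj₂ e × (i , j) ≢ e →
             pair (lookup τ i) (lookup τ j) ≢ pair (lookup τ (proj₁ e)) (lookup τ (proj₂ e))
  distinct {i′ , j′} (i′<j′ , ≢e) eq with pair-injective _ _ _ _ eq
  ... | inj₁ (p , q) = ≢e (cong₂ _,_ (inj p) (inj q))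
  -- The reversed match would be the same edge oriented both ways.
  ... | inj₂ (p , q) with refl ← inj p | refl ← inj q = Fin.<-asym i<j i′<j′

-- After exchanging sums, a given pattern edge lands on a given bit of `Z` for at most 2 n^k tuples:
-- two orientations, k free vertices.
∑-multiplicity : ∀ {n k} (p : Pattern (2 + k)) → Increasing p → ∀ Z →
  ∑ (copies p n) (multiplicity Z) ≤ length p * (length Z * (n ^ k * 2))
∑-multiplicity {n} {k} p inc Z = begin
  ∑ (copies p n) (multiplicity Z) ≡⟨ ∑-map (copy p) T _ ⟩
  ∑ T (λ τ → multiplicity Z (copy p τ)) ≤⟨ ∑-mono T (λ τ → ≤-reflexive (∑-map _ p _)) ⟩
  ∑ T (λ τ → ∑ p (λ e → ∑ Z (hit τ e))) ≡⟨ ∑-comm T p _ ⟩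
  ∑ p (λ e → ∑ T (λ τ → ∑ Z (hit τ e))) ≤⟨ each p inc ⟩
  length p * (length Z * (n ^ k * 2)) ∎
  where
  open ≤-Reasoning
  T = vectors n (2 + k)
  hit : Vec (Fin n) (2 + k) → Fin (2 + k) × Fin (2 + k) → Fin (n * n) → ℕ
  hit τ (i , j) z = δ (pair (lookup τ i) (lookup τ j)) z
  each : ∀ q → Increasing q →
         ∑ q (λ e → ∑ T (λ τ → ∑ Z (hit τ e))) ≤ length q * (length Z * (n ^ k * 2))
  each []      []          = z≤n
  each (e ∷ q) (i<j ∷ inc) = +-mono-≤
    (≤-trans (≤-reflexive (∑-comm T Z (λ τ → hit τ e)))
             (∑-bound Z _ (λ z → ∑-two-coordinates n k i<j (λ u v → δ (pair {n} u v) z) 2 (∑-pair n z))))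
    (each q inc)

biclique : ∀ s t → Pattern (s + t)
biclique s t = cartesianProductWith (λ i j → i ↑ˡ t , s ↑ʳ j) (allFin s) (allFin t)

biclique-length : ∀ s t → length (biclique s t) ≡ s * t
biclique-length s t = trans (length-cartesianProductWith _ (allFin s) (allFin t))
  (cong₂ _*_ (length-allFin s) (length-allFin t))

biclique-increasing : ∀ s t → Increasing (biclique s t)
biclique-increasing s t =
  All.cartesianProductWith⁺ (setoid _) (setoid _) _ (allFin s) (allFin t) λ {i} {j} _ _ → begin-strict
  Fin.toℕ (i ↑ˡ t) ≡⟨ Fin.toℕ-↑ˡ i t ⟩
  Fin.toℕ i        <⟨ Fin.toℕ<n i ⟩
  s                ≤⟨ m≤m+n s _ ⟩
  s + Fin.toℕ j    ≡⟨ sym (Fin.toℕ-↑ʳ s j) ⟩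
  Fin.toℕ (s ↑ʳ j) ∎
  where open ≤-Reasoning

biclique-unique : ∀ s t → Unique (biclique s t)
biclique-unique s t = cartesianProductWith⁺ _
  (λ eq → Fin.↑ˡ-injective t _ _ (cong proj₁ eq) , Fin.↑ʳ-injective s _ _ (cong proj₂ eq))
  (allFin⁺ s) (allFin⁺ t)

triangle : Pattern 3
triangle = (zero , suc zero) ∷ (zero , suc (suc zero)) ∷ (suc zero , suc (suc zero)) ∷ []

triangle-increasing : Increasing triangle
triangle-increasing = s≤s z≤n ∷ s≤s z≤n ∷ s≤s (s≤s z≤n) ∷ []

triangle-unique : Unique triangle
triangle-unique = ((λ ()) ∷ (λ ()) ∷ []) ∷ ((λ ()) ∷ []) ∷ [] ∷ []

tabulate-injective : ∀ {a} {A : Set a} {k} {f : Fin k → A} → Injective _≡_ _≡_ f →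
                     Injective _≡_ _≡_ (lookup (tabulate f))
tabulate-injective {f = f} inj eq =
  inj (trans (sym (lookup∘tabulate f _)) (trans eq (lookup∘tabulate f _)))

-- The random graph

-- With 2 + k vertices and l = 2k + 1 edges, O(n^k) copies pass through a pair while M^l = M (64
-- n)^k, so the orders match and the layer costs at most (1 + 1/M)^y. The 8 in M supplies the 64^k
-- that absorbs 16 l; for triangles this is 48 ≤ 64.
layer-bound : ∀ r k y (p : Pattern (2 + k)) .{{_ : NonZero r}} → Increasing p →
  length p ≡ suc (2 * k) → 16 * length p ≤ 64 ^ k →
  let n = r ^ 2 ; M = 8 * r in
  ∀ {L′} Z → length Z ≡ 4 * y →
  weigh M (certificates Z (copies p n ++ L′)) * M ^ y ≤ suc M ^ y * weigh M (certificates Z L′)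
layer-bound r k y p inc ∣p∣ 16∣p∣≤64^k {L′} Z ∣Z∣ =
  ratio-coarsen M (M ^ l) {{m^n≢0 M l}} K y
    {A = weigh M (certificates Z (copies p n ++ L′))} {B = weigh M (certificates Z L′)} K[1+M]≤1+Y hits
    (weigh-certificates-++ M Z l (copies p n)
      (All.map⁺ (All.universal (λ τ → length-map _ p) (vectors n (2 + k)))))
  where
  open ≤-Reasoning
  n = r ^ 2
  M = 8 * r
  l = length p
  K = 8 * l * n ^ k
  instance
    nonZeroM : NonZero M
    nonZeroM = m*n≢0 8 r
  regroup : ∀ l y m → l * (4 * y * (m * 2)) ≡ 8 * l * m * y
  regroup = solve-∀
  hits : ∑ (copies p n) (multiplicity Z) ≤ K * y
  hits = begin
    ∑ (copies p n) (multiplicity Z) ≤⟨ ∑-multiplicity {n} p inc Z ⟩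
    l * (length Z * (n ^ k * 2))    ≡⟨ cong (λ z → l * (z * (n ^ k * 2))) ∣Z∣ ⟩
    l * (4 * y * (n ^ k * 2))       ≡⟨ regroup l y (n ^ k) ⟩
    K * y                           ∎
  double : ∀ l m M → 8 * l * m * (M + M) ≡ 16 * l * m * M
  double = solve-∀
  K[1+M]≤1+Y : K * suc M ≤ suc (M ^ l)
  K[1+M]≤1+Y = begin
    K * suc M              ≤⟨ *-monoʳ-≤ K (+-monoˡ-≤ M (>-nonZero⁻¹ M)) ⟩
    K * (M + M)            ≡⟨ double l (n ^ k) M ⟩
    16 * l * n ^ k * M     ≤⟨ *-monoˡ-≤ M (*-monoˡ-≤ (n ^ k) 16∣p∣≤64^k) ⟩
    64 ^ k * n ^ k * M     ≡⟨ cong (_* M) (sym (^-distribʳ-* k 64 n)) ⟩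
    (64 * n) ^ k * M       ≡⟨ cong (λ z → z ^ k * M) (sym (^-distribʳ-* 2 8 r)) ⟩
    (M ^ 2) ^ k * M        ≡⟨ cong (_* M) (^-*-assoc M 2 k) ⟩
    M ^ (2 * k) * M        ≡⟨ *-comm (M ^ (2 * k)) M ⟩
    M ^ suc (2 * k)        ≡⟨ cong (M ^_) (sym ∣p∣) ⟩
    M ^ l                  ≤⟨ n≤1+n _ ⟩
    suc (M ^ l)            ∎

-- The trailing `[]` lets `layer-bound` peel off the second pattern in the same way as the first.
forbidden : ∀ n → List (List (Fin (n * n)))
forbidden n = copies triangle n ++ copies (biclique 3 3) n ++ []

-- Absence of the 4y bits contributes (M/(M + 1))^(4y), and each of the two layers gives back at
-- most ((M + 1)/M)^y, so (M/(M + 1))^(2y) remains.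
certificates-bound : ∀ r y .{{_ : NonZero r}} → let n = r ^ 2 ; M = 8 * r in
  ∀ Z → Unique Z → length Z ≡ 4 * y →
  weigh M (certificates Z (forbidden n)) * (suc M ^ y) ^ 2 ≤ (M ^ y) ^ 2 * suc M ^ (n * n)
certificates-bound r y Z u ∣Z∣ = *-cancelʳ-≤ _ _ (m ^ 2 * s ^ 2) {{nz}} (begin
  A * s ^ 2 * (m ^ 2 * s ^ 2)   ≡⟨ shuffle₁ A m s ⟩
  A * m * (m * s ^ 4)           ≤⟨ *-monoˡ-≤ (m * s ^ 4) bound₁ ⟩
  s * A₁ * (m * s ^ 4)          ≡⟨ shuffle₂ s A₁ m ⟩
  A₁ * m * s ^ 5                ≤⟨ *-monoˡ-≤ (s ^ 5) bound₂ ⟩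
  s * A₀ * s ^ 5                ≡⟨ shuffle₃ s A₀ ⟩
  s ^ 4 * A₀ * s ^ 2            ≤⟨ *-monoˡ-≤ (s ^ 2) bound₃ ⟩
  m ^ 4 * N * s ^ 2             ≡⟨ shuffle₄ m N s ⟩
  m ^ 2 * N * (m ^ 2 * s ^ 2)   ∎)
  where
  open ≤-Reasoning
  n = r ^ 2
  M = 8 * r
  m = M ^ y
  s = suc M ^ y
  N = suc M ^ (n * n)
  A = weigh M (certificates Z (forbidden n))
  A₁ = weigh M (certificates Z (copies (biclique 3 3) n ++ []))
  A₀ = weigh M (absent Z)
  nz : NonZero (m ^ 2 * s ^ 2)
  nz = m*n≢0 (m ^ 2) (s ^ 2) {{m^n≢0 m 2 {{m^n≢0 M y {{m*n≢0 8 r}}}}}} {{m^n≢0 s 2 {{m^n≢0 (suc M) y}}}}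
  bound₁ : A * m ≤ s * A₁
  bound₁ = layer-bound r 1 y triangle triangle-increasing refl (≤ᵇ⇒≤ 48 64 _) Z ∣Z∣
  bound₂ : A₁ * m ≤ s * A₀
  bound₂ = layer-bound r 4 y (biclique 3 3) (biclique-increasing 3 3) refl (≤ᵇ⇒≤ 144 16777216 _) {[]} Z ∣Z∣
  power : ∀ x → x ^ length Z ≡ (x ^ y) ^ 4
  power x = trans (cong (x ^_) (trans ∣Z∣ (*-comm 4 y))) (sym (^-*-assoc x y 4))
  bound₃ : s ^ 4 * A₀ ≤ m ^ 4 * N
  bound₃ = subst₂ (λ a b → a * A₀ ≤ b * N) (power (suc M)) (power M) (weigh-absent-all M u)
  shuffle₁ : ∀ a m s → a * (s * (s * 1)) * (m * (m * 1) * (s * (s * 1))) ≡ a * m * (m * (s * (s * (s * (s * 1)))))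
  shuffle₁ = solve-∀
  shuffle₂ : ∀ s a m → s * a * (m * (s * (s * (s * (s * 1))))) ≡ a * m * (s * (s * (s * (s * (s * 1)))))
  shuffle₂ = solve-∀
  shuffle₃ : ∀ s a → s * a * (s * (s * (s * (s * (s * 1))))) ≡ s * (s * (s * (s * 1))) * a * (s * (s * 1))
  shuffle₃ = solve-∀
  shuffle₄ : ∀ m n s → m * (m * (m * (m * 1))) * n * (s * (s * 1)) ≡ m * (m * 1) * n * (m * (m * 1) * (s * (s * 1)))
  shuffle₄ = solve-∀

-- Half the size of the sets considered, of order √n log n with √n = 2^j. It is 2T with T = M (4j +
-- 1), so that its square is 4y for y = T².
side : ℕ → ℕ
side j = 2 * (8 * 2 ^ j * (4 * j + 1))

-- There are n^(4T) = 2^(8jT) tuples. As (1 + 1/M)^M ≥ 2 and y = M (4j + 1) T, the factor (1 +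
-- 1/M)^(2y) is at least 2^(2(4j + 1)T); the + 1 makes the comparison strict.
union-bound : ∀ j → let n = (2 ^ j) ^ 2 ; M = 8 * 2 ^ j ; y = M * (4 * j + 1) * (M * (4 * j + 1)) in
  n ^ (side j + side j) * (M ^ y) ^ 2 < (suc M ^ y) ^ 2
union-bound j = begin-strict
  n ^ (side j + side j) * m ^ 2         ≡⟨ cong (_* m ^ 2) n^ ⟩
  2 ^ (2 * (4 * j * T)) * m ^ 2
    <⟨ *-monoˡ-< (m ^ 2) {{m^n≢0 m 2 {{m^n≢0 M y}}}} (^-monoʳ-< 2 (s≤s (s≤s z≤n)) exponent) ⟩
  2 ^ (2 * (s * T)) * m ^ 2
    ≡⟨ cong (_* m ^ 2) (trans (cong (2 ^_) (*-comm 2 (s * T))) (sym (^-*-assoc 2 (s * T) 2))) ⟩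
  (2 ^ (s * T)) ^ 2 * m ^ 2             ≡⟨ sym (^-distribʳ-* 2 (2 ^ (s * T)) m) ⟩
  (2 ^ (s * T) * m) ^ 2                 ≤⟨ ^-monoˡ-≤ 2 base ⟩
  (suc M ^ y) ^ 2                       ∎
  where
  open ≤-Reasoning
  n = (2 ^ j) ^ 2
  M = 8 * 2 ^ j
  s = 4 * j + 1
  T = M * s
  y = T * T
  m = M ^ y
  instance
    nonZeroM : NonZero M
    nonZeroM = m*n≢0 8 (2 ^ j) {{_}} {{m^n≢0 2 j}}
    nonZeroT : NonZero T
    nonZeroT = m*n≢0 M s {{nonZeroM}} {{subst NonZero (+-comm 1 (4 * j)) _}}
  n^ : n ^ (side j + side j) ≡ 2 ^ (2 * (4 * j * T))
  n^ = trans (cong (_^ (side j + side j)) (^-*-assoc 2 j 2))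
         (trans (^-*-assoc 2 (j * 2) (side j + side j)) (cong (2 ^_) (regroup j T)))
    where
    regroup : ∀ j T → j * 2 * (2 * T + 2 * T) ≡ 2 * (4 * j * T)
    regroup = solve-∀
  exponent : 2 * (4 * j * T) < 2 * (s * T)
  exponent = *-monoʳ-< 2 (*-monoˡ-< T (m<m+n (4 * j) (s≤s z≤n)))
  y≡ : M * (s * T) ≡ y
  y≡ = sym (*-assoc M s T)
  base : 2 ^ (s * T) * m ≤ suc M ^ y
  base = begin
    2 ^ (s * T) * M ^ y             ≡⟨ cong (λ z → 2 ^ (s * T) * M ^ z) (sym y≡) ⟩
    2 ^ (s * T) * M ^ (M * (s * T)) ≡⟨ cong (2 ^ (s * T) *_) (sym (^-*-assoc M M (s * T))) ⟩
    2 ^ (s * T) * (M ^ M) ^ (s * T) ≡⟨ sym (^-distribʳ-* (s * T) 2 (M ^ M)) ⟩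
    (2 * M ^ M) ^ (s * T)           ≤⟨ ^-monoˡ-≤ (s * T) (2*n^n≤[1+n]^n M) ⟩
    (suc M ^ M) ^ (s * T)           ≡⟨ ^-*-assoc (suc M) M (s * T) ⟩
    suc M ^ (M * (s * T))           ≡⟨ cong (suc M ^_) y≡ ⟩
    suc M ^ y                       ∎

-- Only the pairs between the two halves of a tuple are tested. This is stronger than asking for an
-- edge anywhere, and makes `Z` a biclique with exactly 4y pairs.
Independent : ∀ j → let n = (2 ^ j) ^ 2 in Vec Bool (n * n) → Set
Independent j ω = ∀ (τ : Vec (Fin n) (side j + side j)) → Injective _≡_ _≡_ (lookup τ) →
  ¬ (∀ {z} → z ∈ copy (biclique (side j) (side j)) τ → lookup (strip (forbidden n) ω) z ≢ true)
  where n = (2 ^ j) ^ 2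

-- Each tuple emptied by the deletions would have a certificate, but the expected total number of
-- certificates is below 1, so for some `ω` there are none.
existence : ∀ j → ∃ (Independent j)
existence j = ω , λ τ inj off → <⇒≱ Uω<1 (begin
  1        ≤⟨ certificates-positive (Z τ) (forbidden n) ω (agree (λ _ p → p) (λ _ p → p)) off ⟩
  certificates (Z τ) (forbidden n) ω
    ≡⟨ sym (weight-unique τ ω
         (copy-unique {τ = τ} inj (biclique-increasing t t) (biclique-unique t t))) ⟩
  weight τ ω ≤⟨ ∈⇒≤∑ (λ σ → weight σ ω) (∈-vectors τ) ⟩
  U ω      ∎)
  where
  open ≤-Reasoning
  n = (2 ^ j) ^ 2
  M = 8 * 2 ^ j
  t = side j
  T = M * (4 * j + 1)
  y = T * T
  instance
    nonZeroR : NonZero (2 ^ j)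
    nonZeroR = m^n≢0 2 j
  Z : Vec (Fin n) (t + t) → List (Fin (n * n))
  Z = copy (biclique t t)
  unique? : ∀ τ → Dec (Unique (Z τ))
  unique? τ = allPairs? (λ x y → ¬? (x Fin.≟ y)) (Z τ)
  -- `certificates-bound` requires distinct pairs, so tuples with repeated pairs get weight 0;
  -- injective tuples keep their certificates.
  weight : Vec (Fin n) (t + t) → Vec Bool (n * n) → ℕ
  weight τ ω with unique? τ
  ... | yes _ = certificates (Z τ) (forbidden n) ω
  ... | no _  = 0
  weight-unique : ∀ τ ω → Unique (Z τ) → weight τ ω ≡ certificates (Z τ) (forbidden n) ω
  weight-unique τ ω u with unique? τ
  ... | yes _ = refl
  ... | no ¬u = contradiction u ¬u
  ∣Z∣ : ∀ τ → length (Z τ) ≡ 4 * y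
  ∣Z∣ τ = trans (length-map _ (biclique t t)) (trans (biclique-length t t) (square T))
    where
    square : ∀ T → 2 * T * (2 * T) ≡ 4 * (T * T)
    square = solve-∀
  s² = (suc M ^ y) ^ 2
  b = (M ^ y) ^ 2 * suc M ^ (n * n)
  weight-bound : ∀ τ → s² * weigh M (weight τ) ≤ b
  weight-bound τ with unique? τ
  ... | yes u = ≤-trans (≤-reflexive (*-comm s² _)) (certificates-bound (2 ^ j) y (Z τ) u (∣Z∣ τ))
  ... | no _  = ≤-trans (≤-reflexive (trans (cong (s² *_) (weigh-0 M {n * n})) (*-zeroʳ s²))) z≤n
  U : Vec Bool (n * n) → ℕ
  U ω = ∑ (vectors n (t + t)) (λ τ → weight τ ω)
  U<1 : weigh M U < weigh M {n * n} (λ _ → 1)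
  U<1 = *-cancelˡ-< s² _ _ (begin-strict
    s² * weigh M U                                     ≡⟨ cong (s² *_) (weigh-∑ M (vectors n (t + t)) weight) ⟩
    s² * ∑ (vectors n (t + t)) (λ τ → weigh M (weight τ)) ≡⟨ sym (∑-*ˡ (vectors n (t + t)) s² _) ⟩
    ∑ (vectors n (t + t)) (λ τ → s² * weigh M (weight τ)) ≤⟨ ∑-bound (vectors n (t + t)) b weight-bound ⟩
    length (vectors n (t + t)) * b                     ≡⟨ cong (_* b) (length-vectors n (t + t)) ⟩
    n ^ (t + t) * ((M ^ y) ^ 2 * suc M ^ (n * n))      ≡⟨ sym (*-assoc (n ^ (t + t)) ((M ^ y) ^ 2) _) ⟩
    n ^ (t + t) * (M ^ y) ^ 2 * suc M ^ (n * n)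
      <⟨ *-monoˡ-< (suc M ^ (n * n)) {{m^n≢0 (suc M) (n * n)}} (union-bound j) ⟩
    s² * suc M ^ (n * n)                               ≡⟨ cong (s² *_) (sym (weigh-1 M {n * n})) ⟩
    s² * weigh M {n * n} (λ _ → 1)                     ∎)
  ω = proj₁ (averaging M {h = U} {k = λ _ → 1} U<1)
  Uω<1 = proj₂ (averaging M {h = U} {k = λ _ → 1} U<1)

-- Cliques and colourings of graphs with independence number at most two

module Dense (G : Graph) (E? : ∀ u v → Dec (E G u v))
  (dense : ∀ {u v w} → u ≢ v → u ≢ w → v ≢ w → ¬ E G u v → ¬ E G u w → ¬ E G v w → ⊥) where

  Complete : ∀ {k} → Vec (Fin (order G)) k → Set
  Complete τ = ∀ i j → i ≢ j → E G (lookup τ i) (lookup τ j)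

  complete? : ∀ {k} (τ : Vec (Fin (order G)) k) → Dec (Complete τ)
  complete? τ = Fin.all? λ i → Fin.all? λ j → ¬? (i Fin.≟ j) →-dec E? (lookup τ i) (lookup τ j)

  adjacent⇒injective : ∀ {k} {f : Fin k → Fin (order G)} → (∀ i j → i ≢ j → E G (f i) (f j)) →
                       Injective _≡_ _≡_ f
  adjacent⇒injective {f = f} adj {i} {j} eq with i Fin.≟ j
  ... | yes i≡j = i≡j
  ... | no i≢j  = contradiction (subst (E G (f i)) (sym eq) (adj i j i≢j)) (irrefl G)

  -- Exhaustive search over tuples; injectivity comes for free, because the graph has no loops.
  hasClique? : ∀ k → Dec (HasClique G k)
  hasClique? k = map′
    (λ any → let τ , adj = satisfied any in lookup τ , adjacent⇒injective adj , adj)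
    (λ (f , _ , adj) → Any.map
      (λ { refl i j i≢j → subst₂ (E G) (sym (lookup∘tabulate f i)) (sym (lookup∘tabulate f j)) (adj i j i≢j) })
      (∈-vectors (tabulate f)))
    (Any.any? complete? (vectors (order G) k))

  hasClique-≤ : ∀ {k l} → k ≤ l → HasClique G l → HasClique G k
  hasClique-≤ k≤l (f , inj , adj) =
    (λ i → f (Fin.inject≤ i k≤l)) ,
    (λ eq → Fin.inject≤-injective k≤l k≤l _ _ (inj eq)) ,
    (λ i j i≢j → adj _ _ (i≢j ∘ Fin.inject≤-injective k≤l k≤l i j))

  -- An upward search with `d` as fuel, which cannot run out because size d + k is excluded.
  cliqueNumber-between : ∀ d {k} → HasClique G k → ¬ HasClique G (d + k) →
                         ∃ λ w → CliqueNumber G w × k ≤ w × w < d + k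
  cliqueNumber-between zero    {k} yk nk = contradiction yk nk
  cliqueNumber-between (suc d) {k} yk nk with hasClique? (suc k)
  ... | no ¬clique = k , (yk , ¬clique) , ≤-refl , s≤s (m≤n+m k d)
  ... | yes clique =
    let w , cn , k<w , w< = cliqueNumber-between d clique (nk ∘ subst (HasClique G) (+-suc d k))
    in w , cn , <⇒≤ k<w , subst (w <_) (+-suc d k) w<

  list⇒clique : ∀ {I} → AllPairs (E G) I → HasClique G (length I)
  list⇒clique {I} ap = List.lookup I , adjacent⇒injective (adj ap) , adj ap
    where
    adj : ∀ {I} → AllPairs (E G) I → ∀ i j → i ≢ j → E G (List.lookup I i) (List.lookup I j)
    adj (_ ∷ _)   zero    zero    i≢j = contradiction refl i≢j
    adj (xs ∷ _)  zero    (suc j) i≢j = All.lookup xs (∈-lookup j)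
    adj (xs ∷ _)  (suc i) zero    i≢j = Graph.sym G (All.lookup xs (∈-lookup i))
    adj (_ ∷ ap)  (suc i) (suc j) i≢j = adj ap i j (i≢j ∘ cong suc)

  -- Two nonadjacent nonneighbours of `x` would form an independent triple with it.
  nonneighbours-complete : ∀ {x ys} → All (λ y → x ≢ y × ¬ E G x y) ys → Unique ys →
                           AllPairs (E G) ys
  nonneighbours-complete [] [] = []
  nonneighbours-complete ((x≢y , ¬xy) ∷ ps) (y∉ys ∷ u) =
    All.zipWith (λ ((x≢z , ¬xz) , y≢z) →
      decidable-stable (E? _ _) (dense x≢y x≢z y≢z ¬xy ¬xz)) (ps , y∉ys)
    ∷ nonneighbours-complete ps u

  length-filter-¬ : ∀ x ys → length (filter (E? x) ys) + length (filter (¬? ∘ E? x) ys) ≡ length ys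
  length-filter-¬ x []       = refl
  length-filter-¬ x (y ∷ ys) with E? x y
  ... | yes _ = cong suc (length-filter-¬ x ys)
  ... | no _  = trans (+-suc _ _) (cong suc (length-filter-¬ x ys))

  -- If `x` has N nonneighbours, they form a clique. Otherwise `x` and its nonneighbours take up at
  -- most N entries, and the search for k - 1 further vertices continues among its neighbours.
  ramsey : ∀ N k xs → Unique xs → k * N ≤ length xs →
    HasClique G N ⊎ ∃ λ I → All (_∈ xs) I × AllPairs (E G) I × length I ≡ k
  ramsey N zero xs u _ = inj₂ ([] , [] , [] , refl)
  -- Here N is 0, so the empty clique serves.
  ramsey N (suc k) [] u N+kN≤0 =
    inj₁ (hasClique-≤ (m+n≤o⇒m≤o N N+kN≤0) (list⇒clique []))
  ramsey N (suc k) (x ∷ ys) (x∉ys ∷ u) N+kN≤∣xs∣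
    with N ≤? length (filter (¬? ∘ E? x) ys)
  ... | yes N≤ = inj₁ (hasClique-≤ N≤ (list⇒clique (nonneighbours-complete
    (All.zip (All.filter⁺ (¬? ∘ E? x) x∉ys , All.all-filter (¬? ∘ E? x) ys))
    (filter⁺ (¬? ∘ E? x) u))))
  ... | no N≰ with ramsey N k (filter (E? x) ys) (filter⁺ (E? x) u) kN≤
    where
    a = length (filter (E? x) ys)
    b = length (filter (¬? ∘ E? x) ys)
    open ≤-Reasoning
    kN≤ : k * N ≤ a
    kN≤ = +-cancelˡ-≤ N _ _ (begin
      N + k * N          ≤⟨ N+kN≤∣xs∣ ⟩
      suc (length ys)    ≡⟨ cong suc (sym (length-filter-¬ x ys)) ⟩
      suc (a + b)        ≡⟨ sym (+-suc a b) ⟩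
      a + suc b          ≤⟨ +-monoʳ-≤ a (≰⇒> N≰) ⟩
      a + N              ≡⟨ +-comm a N ⟩
      N + a              ∎)
  ...   | inj₁ clique = inj₁ clique
  ...   | inj₂ (I , I⊆ , ap , ∣I∣) = inj₂
    ( x ∷ I
    , here refl ∷ All.map (there ∘ proj₁ ∘ ∈-filter⁻ (E? x) {xs = ys}) I⊆
    , All.map (proj₂ ∘ ∈-filter⁻ (E? x) {xs = ys}) I⊆ ∷ ap
    , cong suc ∣I∣ )

  clique-√ : ∀ N → N * N ≤ order G → HasClique G N
  clique-√ N N²≤n with ramsey N N (allFin (order G)) (allFin⁺ (order G))
                         (≤-trans N²≤n (≤-reflexive (sym (length-allFin (order G)))))
  ... | inj₁ clique             = clique
  ... | inj₂ (_ , _ , ap , refl) = list⇒clique ap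

  -- Colour classes have at most two vertices; the bit says whether v is the second one in its class.
  colouring-bound : ∀ {k} → ProperColouring G k → order G ≤ k * 2
  colouring-bound {k} (c , proper) = Fin.injective⇒≤ {f = f} f-injective
    where
    Earlier : Fin (order G) → Set
    Earlier v = ∃ λ u → u Fin.< v × c u ≡ c v
    earlier? : ∀ v → Dec (Earlier v)
    earlier? v = Fin.any? λ u → u Fin.<? v ×-dec c u Fin.≟ c v
    bit : ∀ {v} → Dec (Earlier v) → Fin 2
    bit (yes _) = suc zero
    bit (no _)  = zero
    f : Fin (order G) → Fin (k * 2)
    f v = combine (c v) (bit (earlier? v))
    monochromatic : ∀ {u v} → c u ≡ c v → ¬ E G u v
    monochromatic cu≡cv e = proper _ _ e cu≡cv
    no-three : ∀ {v w} → v Fin.< w → c v ≡ c w → bit (earlier? v) ≡ bit (earlier? w) → ⊥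
    no-three {v} {w} v<w cv≡cw eq with earlier? v | earlier? w
    ... | _ | no ¬earlier = ¬earlier (v , v<w , cv≡cw)
    ... | yes (u , u<v , cu≡cv) | yes _ =
      dense (Fin.<⇒≢ u<v) (Fin.<⇒≢ (Fin.<-trans u<v v<w)) (Fin.<⇒≢ v<w)
        (monochromatic cu≡cv) (monochromatic (trans cu≡cv cv≡cw)) (monochromatic cv≡cw)
    f-injective : Injective _≡_ _≡_ f
    f-injective {v} {w} eq with Fin.combine-injective (c v) (bit (earlier? v)) (c w) (bit (earlier? w)) eq
    ... | cv≡cw , bits with Fin.<-cmp v w
    ...   | tri≈ _ v≡w _ = v≡w
    ...   | tri< v<w _ _ = contradiction bits (no-three v<w cv≡cw)
    ...   | tri> _ _ w<v = contradiction (sym bits) (no-three w<v (sym cv≡cw))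

-- The complement graph

module Complement {n₀ : ℕ} (ω : Vec Bool (n₀ * n₀)) where

  F : Vec Bool (n₀ * n₀)
  F = strip (forbidden n₀) ω

  Joined : Fin n₀ → Fin n₀ → Set
  Joined u v = lookup F (pair u v) ≡ true

  joined-sym : ∀ u v → Joined u v → Joined v u
  joined-sym u v = subst (λ z → lookup F z ≡ true) (pair-sym u v)

  joined? : ∀ u v → Dec (Joined u v)
  joined? u v = lookup F (pair u v) Bool.≟ true

  H : Graph
  H = record
    { n      = n₀
    ; E      = λ u v → u ≢ v × ¬ Joined u v
    ; sym    = λ {u} {v} (u≢v , ¬uv) → u≢v ∘ sym , ¬uv ∘ joined-sym v u
    ; irrefl = λ (u≢u , _) → u≢u refl
    }

  E? : ∀ u v → Dec (E H u v)
  E? u v = ¬? (u Fin.≟ v) ×-dec ¬? (joined? u v)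

  ¬E⇒joined : ∀ {u v} → u ≢ v → ¬ E H u v → Joined u v
  ¬E⇒joined {u} {v} u≢v ¬e = decidable-stable (joined? u v) (λ ¬uv → ¬e (u≢v , ¬uv))

  no-copy : ∀ {k} (p : Pattern k) → 0 < length p → Increasing p → Unique p →
            (∀ (τ : Vec (Fin n₀) k) → copy p τ ∈ forbidden n₀) →
            (f : Fin k → Fin n₀) → Injective _≡_ _≡_ f → ¬ All (λ (i , j) → Joined (f i) (f j)) p
  no-copy p@(_ ∷ _) _ inc u p∈ f inj joined =
    strip-free {L = forbidden n₀} ω (p∈ τ) (copy-unique {τ = τ} (tabulate-injective inj) inc u)
      (All.map⁺ (All.map (λ {(i , j)} →
        subst₂ Joined {f i} {lookup τ i} {f j} {lookup τ j}
          (sym (lookup∘tabulate f i)) (sym (lookup∘tabulate f j))) joined))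
    where
    τ = tabulate f

  triangle-free : ∀ {u v w} → u ≢ v → u ≢ w → v ≢ w →
                  Joined u v → Joined u w → Joined v w → ⊥
  triangle-free {u} {v} {w} u≢v u≢w v≢w uv uw vw =
    no-copy triangle (s≤s z≤n) triangle-increasing triangle-unique
      (λ τ → ∈-++⁺ˡ (∈-map⁺ (copy {n₀} triangle) (∈-vectors τ)))
      (lookup (u ∷ v ∷ w ∷ [])) inj (uv ∷ uw ∷ vw ∷ [])
    where
    inj : Injective _≡_ _≡_ (lookup (u ∷ v ∷ w ∷ []))
    inj {zero}          {zero}          eq = refl
    inj {zero}          {suc zero}      eq = contradiction eq u≢v
    inj {zero}          {suc (suc zero)} eq = contradiction eq u≢w
    inj {suc zero}      {zero}          eq = contradiction (sym eq) u≢v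
    inj {suc zero}      {suc zero}      eq = refl
    inj {suc zero}      {suc (suc zero)} eq = contradiction eq v≢w
    inj {suc (suc zero)} {zero}         eq = contradiction (sym eq) u≢w
    inj {suc (suc zero)} {suc zero}     eq = contradiction (sym eq) v≢w
    inj {suc (suc zero)} {suc (suc zero)} eq = refl

  biclique-free : (f g : Fin 3 → Fin n₀) → Injective _≡_ _≡_ f → Injective _≡_ _≡_ g →
                  (∀ i j → f i ≢ g j) → ¬ (∀ i j → Joined (f i) (g j))
  biclique-free f g f-inj g-inj f≢g joined =
    no-copy (biclique 3 3) (s≤s z≤n) (biclique-increasing 3 3) (biclique-unique 3 3)
      (λ τ → ∈-++⁺ʳ (copies triangle n₀) (∈-++⁺ˡ (∈-map⁺ (copy {n₀} (biclique 3 3)) (∈-vectors τ))))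
      h h-inj
      (All.cartesianProductWith⁺ (setoid _) (setoid _) (λ i j → i ↑ˡ 3 , 3 ↑ʳ j)
        (allFin 3) (allFin 3) λ {i} {j} _ _ →
        subst₂ Joined {f i} {h (i ↑ˡ 3)} {g j} {h (3 ↑ʳ j)}
                      (cong [ f , g ]′ (sym (Fin.splitAt-↑ˡ 3 i 3)))
                      (cong [ f , g ]′ (sym (Fin.splitAt-↑ʳ 3 3 j))) (joined i j))
    where
    h : Fin 6 → Fin n₀
    h i = [ f , g ]′ (Fin.splitAt 3 i)
    sum-inj : ∀ (a b : Fin 3 ⊎ Fin 3) → [ f , g ]′ a ≡ [ f , g ]′ b → a ≡ b
    sum-inj (inj₁ i) (inj₁ j) eq = cong inj₁ (f-inj eq)
    sum-inj (inj₁ i) (inj₂ j) eq = contradiction eq (f≢g i j)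
    sum-inj (inj₂ i) (inj₁ j) eq = contradiction (sym eq) (f≢g j i)
    sum-inj (inj₂ i) (inj₂ j) eq = cong inj₂ (g-inj eq)
    h-inj : Injective _≡_ _≡_ h
    h-inj {i} {j} eq = trans (sym (Fin.join-splitAt 3 3 i))
      (trans (cong (Fin.join 3 3) (sum-inj (Fin.splitAt 3 i) (Fin.splitAt 3 j) eq)) (Fin.join-splitAt 3 3 j))

  dense : ∀ {u v w} → u ≢ v → u ≢ w → v ≢ w → ¬ E H u v → ¬ E H u w → ¬ E H v w → ⊥
  dense u≢v u≢w v≢w ¬uv ¬uw ¬vw =
    triangle-free u≢v u≢w v≢w (¬E⇒joined u≢v ¬uv) (¬E⇒joined u≢w ¬uw) (¬E⇒joined v≢w ¬vw)

  -- An induced cycle of length at least 5 has two nonadjacent vertices, which together with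
  -- any vertex of the other cycle would be independent.
  long-cycle : ∀ k {f : Fin (oddLen (suc k)) → Fin n₀} {x} → InducedOddCycle H (suc k) f →
               (∀ i → f i ≢ x) → ¬ (∀ i → ¬ E H (f i) x)
  long-cycle k {f} (inj , adj) f≢x ¬fx =
    dense (λ eq → contradiction (inj eq) λ ()) (f≢x zero) (f≢x two)
      (λ e → not-consecutive (proj₁ (adj zero two) e)) (¬fx zero) (¬fx two)
    where
    two : Fin (oddLen (suc k))
    two = suc (suc zero)
    not-consecutive : ¬ CycAdj (2 + 2 * suc k) zero two
    not-consecutive (inj₁ ())
    not-consecutive (inj₂ ())

  iocp≤1 : IOCP≤1 H
  iocp≤1 (suc k , _ , f , g , cyc , _ , f≢g , ¬fg) =
    long-cycle k cyc (λ i → f≢g i zero) (λ i → ¬fg i zero)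
  iocp≤1 (zero , suc k , f , g , _ , cyc , f≢g , ¬fg) =
    long-cycle k cyc (λ j → f≢g zero j ∘ sym) (λ j → ¬fg zero j ∘ Graph.sym H)
  -- `oddLen zero` is 3, so both cycles are triangles, and the missing edges between them form a
  -- K₃,₃ in F.
  iocp≤1 (zero , zero , f , g , (f-inj , _) , (g-inj , _) , f≢g , ¬fg) =
    biclique-free f g f-inj g-inj f≢g (λ i j → ¬E⇒joined (f≢g i j) (¬fg i j))

  -- No two vertices of a clique of H are joined in F, in particular no two across its halves, which
  -- `indep` excludes.
  ¬hasClique : ∀ t →
    (∀ (τ : Vec (Fin n₀) (t + t)) → Injective _≡_ _≡_ (lookup τ) →
      ¬ (∀ {z} → z ∈ copy (biclique t t) τ → lookup F z ≢ true)) →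
    ¬ HasClique H (t + t)
  ¬hasClique t indep (f , inj , adj) = indep τ (tabulate-injective inj) off
    where
    τ = tabulate f
    off : ∀ {z} → z ∈ copy (biclique t t) τ → lookup F z ≢ true
    off z∈ with (i , j) , ij∈ , refl ← ∈-map⁻ _ z∈ =
      subst₂ (λ u v → ¬ Joined u v) (sym (lookup∘tabulate f i)) (sym (lookup∘tabulate f j))
        (proj₂ (adj i j (Fin.<⇒≢ (All.lookup (biclique-increasing t t) ij∈))))

  open Dense H E? dense public

-- Choice of parameters and assembly of the family

n<2^n : ∀ n → n < 2 ^ n
n<2^n zero    = s≤s z≤n
n<2^n (suc n) = begin-strict
  suc n             ≤⟨ n<2^n n ⟩
  2 ^ n             <⟨ m<m+n (2 ^ n) (s≤s z≤n) ⟩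
  2 ^ n + suc n     ≤⟨ +-monoʳ-≤ (2 ^ n) (≤-trans (n<2^n n) (m≤m+n _ 0)) ⟩
  2 ^ n + (2 ^ n + 0) ∎
  where open ≤-Reasoning

clique-size-bound : ∃ λ c → 1 ≤ c × ∀ j → 1 ≤ j → side j + side j ≤ c * (2 ^ j * j)
-- 160 = 32 * 5, where 4j + 1 ≤ 5j for j ≥ 1.
clique-size-bound = 160 , s≤s z≤n , λ j 1≤j → begin
  side j + side j            ≡⟨ collect (2 ^ j) j ⟩
  32 * (2 ^ j * (4 * j + 1)) ≤⟨ *-monoʳ-≤ 32 (*-monoʳ-≤ (2 ^ j) (+-monoʳ-≤ (4 * j) 1≤j)) ⟩
  32 * (2 ^ j * (4 * j + j)) ≡⟨ expand (2 ^ j) j ⟩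
  160 * (2 ^ j * j)          ∎
  where
  open ≤-Reasoning
  collect : ∀ r j → 2 * (8 * r * (4 * j + 1)) + 2 * (8 * r * (4 * j + 1)) ≡ 32 * (r * (4 * j + 1))
  collect = solve-∀
  expand : ∀ r j → 32 * (r * (4 * j + j)) ≡ 160 * (r * j)
  expand = solve-∀

-- For w ≤ 2ʲ the trivial bound w² ≤ n suffices; otherwise log w ≥ j.
colours-vs-clique : ∀ c j {k w} → 1 ≤ c → (2 ^ j) ^ 2 ≤ k * 2 → 2 ≤ w → w ≤ c * (2 ^ j * j) →
                    w * w ≤ c * c * 2 * (k * (⌈log₂ w ⌉ * ⌈log₂ w ⌉))
colours-vs-clique c j {k} {w} 1≤c n≤2k 2≤w w≤ with w ≤? 2 ^ j
... | yes w≤r = begin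
  w * w                       ≤⟨ *-mono-≤ w≤r w≤r ⟩
  2 ^ j * 2 ^ j               ≡⟨ square (2 ^ j) ⟩
  (2 ^ j) ^ 2                 ≤⟨ n≤2k ⟩
  k * 2                       ≡⟨ pad k ⟩
  1 * 1 * 2 * (k * (1 * 1))
    ≤⟨ *-mono-≤ (*-monoˡ-≤ 2 (*-mono-≤ 1≤c 1≤c)) (*-monoʳ-≤ k (*-mono-≤ 1≤l 1≤l)) ⟩
  c * c * 2 * (k * (l * l))   ∎
  where
  open ≤-Reasoning
  l = ⌈log₂ w ⌉
  1≤l : 1 ≤ l
  1≤l = ≤-trans (≤-reflexive (sym (⌈log₂2^n⌉≡n 1))) (⌈log₂⌉-mono-≤ 2≤w)
  square : ∀ r → r * r ≡ r * (r * 1)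
  square = solve-∀
  pad : ∀ k → k * 2 ≡ 1 * 1 * 2 * (k * (1 * 1))
  pad = solve-∀
... | no w≰r = begin
  w * w                               ≤⟨ *-mono-≤ w≤ w≤ ⟩
  c * (2 ^ j * j) * (c * (2 ^ j * j)) ≡⟨ regroup c (2 ^ j) j ⟩
  c * c * ((2 ^ j) ^ 2 * (j * j))     ≤⟨ *-monoʳ-≤ (c * c) (*-mono-≤ n≤2k (*-mono-≤ j≤l j≤l)) ⟩
  c * c * (k * 2 * (l * l))           ≡⟨ collect (c * c) k (l * l) ⟩
  c * c * 2 * (k * (l * l))           ∎
  where
  open ≤-Reasoning
  l = ⌈log₂ w ⌉
  j≤l : j ≤ l
  j≤l = ≤-trans (≤-reflexive (sym (⌈log₂2^n⌉≡n j))) (⌈log₂⌉-mono-≤ (≰⇒≥ w≰r))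
  regroup : ∀ c r j → c * (r * j) * (c * (r * j)) ≡ c * c * (r * (r * 1) * (j * j))
  regroup = solve-∀
  collect : ∀ c k l → c * (k * 2 * l) ≡ c * 2 * (k * l)
  collect = solve-∀

-- `d` is the reciprocal of the constant c of the theorem, and quantifying over all proper
-- colourings bounds χ from below.
Extremal : ℕ → ℕ → Graph → Set
Extremal d N H = IOCP≤1 H × ∃ λ w → CliqueNumber H w × N ≤ w ×
  ((k : ℕ) → ProperColouring H k → w * w ≤ d * (k * (⌈log₂ w ⌉ * ⌈log₂ w ⌉)))

-- With j = N there are (2^N)² ≥ N² vertices, so the parameter of the random graph also guarantees a
-- clique of size N.
extremal : ∀ c → 1 ≤ c → (∀ j → 1 ≤ j → side j + side j ≤ c * (2 ^ j * j)) →
           ∀ N → 2 ≤ N → ∃ (Independent N) → Σ Graph (Extremal (c * c * 2) N)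
extremal c 1≤c size N 2≤N (ω , independent) = H , iocp≤1 , w , proj₁ w-clique , N≤w , λ k colouring →
  colours-vs-clique c N {k} 1≤c (colouring-bound colouring) (≤-trans 2≤N N≤w)
    (≤-trans (<⇒≤ (proj₂ (proj₂ w-clique)))
      (≤-trans (≤-reflexive d+N≡t) (size N (≤-trans (s≤s z≤n) 2≤N))))
  where
  open Complement {(2 ^ N) ^ 2} ω
  t = side N + side N
  ¬clique : ¬ HasClique H t
  ¬clique = ¬hasClique (side N) independent
  N≤2^N : N ≤ 2 ^ N
  N≤2^N = <⇒≤ (n<2^n N)
  clique : HasClique H N
  clique = clique-√ N (*-mono-≤ N≤2^N (≤-trans N≤2^N (m≤m*n (2 ^ N) 1)))
  N≤t : N ≤ t
  N≤t = ≮⇒≥ λ t<N → ¬clique (hasClique-≤ (<⇒≤ t<N) clique)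
  -- The gap between the clique found and the excluded size is the fuel for locating the clique
  -- number.
  d = proj₁ (m≤n⇒∃[o]m+o≡n N≤t)
  d+N≡t : d + N ≡ t
  d+N≡t = trans (+-comm d N) (proj₂ (m≤n⇒∃[o]m+o≡n N≤t))
  between = cliqueNumber-between d clique (¬clique ∘ subst (HasClique H) d+N≡t)
  w = proj₁ between
  w-clique = proj₂ between
  N≤w : N ≤ w
  N≤w = proj₁ (proj₂ w-clique)

extremal-exists : (∃ λ c → 1 ≤ c × ∀ j → 1 ≤ j → side j + side j ≤ c * (2 ^ j * j)) →
                  ∃ λ d → 1 ≤ d × ∀ N → 2 ≤ N → Σ Graph (Extremal d N)
extremal-exists (c , 1≤c , size) =
  c * c * 2 , 1≤c*c*2 , λ N 2≤N → extremal c 1≤c size N 2≤N (existence N)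
  where
  1≤c*c*2 : 1 ≤ c * c * 2
  1≤c*c*2 = *-mono-≤ {1} {c * c} {1} {2} (*-mono-≤ 1≤c 1≤c) (s≤s z≤n)

unbounded : ∀ d → (∀ N → 2 ≤ N → Σ Graph (Extremal d N)) →
            ∀ N → Σ Graph λ H → Extremal d 2 H × Σ ℕ λ w → CliqueNumber H w × N ≤ w
-- Asking for 2 + N serves both the fixed bound 2 of the family and the given N.
unbounded d ex N with ex (2 + N) (s≤s (s≤s z≤n))
... | H , iocp , w , cn , 2+N≤w , bound =
  H , (iocp , w , cn , ≤-trans (s≤s (s≤s z≤n)) 2+N≤w , bound) , w , cn , ≤-trans (m≤n+m N 2) 2+N≤w

theorem10 : Σ ℕ λ d → 1 ≤ d × Σ (Graph → Set) λ 𝓗 →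
    ((H : Graph) → 𝓗 H → IOCP≤1 H × Σ ℕ λ w → CliqueNumber H w × 2 ≤ w ×
    ((k : ℕ) → ProperColouring H k → w * w ≤ d * (k * (⌈log₂ w ⌉ * ⌈log₂ w ⌉))))
    × ((N : ℕ) → Σ Graph λ H → 𝓗 H × Σ ℕ λ w → CliqueNumber H w × N ≤ w)
-- The family consists of all graphs that satisfy the bounds with this `d`; the constructed ones
-- show that its clique numbers are unbounded.
theorem10 =
  let d , 1≤d , extremal-graph = extremal-exists clique-size-bound
  in d , 1≤d , Extremal d 2 , (λ _ extr → extr) , unbounded d extremal-graph
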